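{- The category $\mathbf{KS}$ of Kegelspitzen and affine Scott-continuous maps is equivalent to the category $[\mathbb{L}_{\leq 1},\mathbf{Dcpo}_{\perp!}]_\times$ of models of the $\mathbf{Dcpo}_{\perp!}$-enriched Lawvere theory $\mathbb{L}_{\leq 1}$ of subconvex sets, i.e. the category of finite product-preserving locally strict Scott-continuous functors $\mathbb{L}_{\leq 1}\to\mathbf{Dcpo}_{\perp!}$ and natural transformations between them.
   Context: A convex set is a set $X$ with, for each vector $\vec r=(r_1,\dots,r_m)$ of non-negative reals with $\sum_i r_i=1$, an operation $X^m\to X$, $(x_i)_i\mapsto\sum_i r_i\cdot x_i$, such that $\sum_j \delta_{ij}\cdot x_j=x_i$ (with $\delta_{ij}$ the Kronecker delta) and $\sum_i r_i\cdot(\sum_j s_{i,j}\cdot x_j)=\sum_j(\sum_i r_i s_{i,j})\cdot x_j$ for every $m\times n$ matrix $(s_{i,j})$ of non-negative reals with $\sum_j s_{i,j}=1$ for each $i$. Affine maps are functions preserving these operations. Write $x\oplus_\lambda y=\lambda\cdot x+(1-\lambda)\cdot y$ for $\lambda\in[0,1]$. A convex dcpo is a convex set with a dcpo structure such that all the operations $X^m\to X$ are Scott-continuous. A pointed convex dcpo is a convex dcpo with a least element $\perp$, which serves as zero element of the convex structure: for non-negative $r_i$ with $\sum_i r_i\le 1$ one sets $\sum_i r_i\cdot x_i:=\sum_i r_i\cdot x_i+(1-\sum_i r_i)\cdot\perp$. A Kegelspitze is a pointed convex dcpo $X$ such that the scalar multiplication $[0,1]\times X\to X$, $\lambda\cdot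 x=x\oplus_\lambda\perp$, is Scott-continuous in both arguments. $\mathbf{KS}$ is the category of Kegelspitzen and affine strict Scott-continuous maps (called "affine Scott-continuous maps"), where strict means preserving $\perp$. $\mathbf{Dcpo}_{\perp!}$ is the category of pointed dcpos and strict Scott-continuous maps; its hom-sets are pointed dcpos under the pointwise order. For $n\in\mathbb N$ let $\mathcal D^\infty_{\leq 1}(n)=\{(q_1,\dots,q_n)\in[0,1]^n\mid\sum_k q_k\le 1\}$ with the pointwise order. $\mathbb{L}_{\leq 1}$ is the category whose objects are the natural numbers and with $\mathbb{L}_{\leq 1}(n,m)=\mathcal D^\infty_{\leq 1}(n)^m$: an arrow $n\to m$ is an $m$-indexed family of sub-probability vectors on $n$ (a Kleisli map $m\to\mathcal D_{\leq 1}^\infty(n)$). The composite of $f:n\to m$ and $g:m\to p$ is $(g\circ f)(k)(i)=\sum_j g(k)(j)\,f(j)(i)$, and the identity on $n$ is the family of Dirac vectors. Thus $\mathbb{L}_{\leq1}$ is the opposite of the Kleisli category of the sub-distribution monad restricted to natural numbers; hom-sets are pointed dcpos under the pointwise order, and finite products in $\mathbb{L}_{\leq 1}$ are given by addition of natural numbers. A functor $F$ between $\mathbf{Dcpo}_{\perp!}$-enriched categories is locally strict Scott-continuous if each map $F_{X,Y}$ on hom-sets is strict and Scott-continuous. -}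

module Defs where

open import Level using (Level; _⊔_) renaming (zero to 0ℓ; suc to lsuc)
open import Algebra.Bundles using (CommutativeRing)
import Algebra.Properties.Ring as RingProperties
import Algebra.Properties.Semiring.Sum as SemiringSum
open import Data.Bool.Base as Bool using (if_then_else_)
open import Data.Empty using (⊥-elim)
open import Data.Fin.Base using (Fin; zero; suc)
open import Data.Fin.Properties using (_≟_)
open import Data.Nat.Base using (ℕ; zero; suc)
open import Data.Product.Base using (Σ; Σ-syntax; ∃; ∃-syntax; _×_; _,_; proj₁; proj₂)
open import Data.Sum.Base using (inj₁; inj₂)
open import Data.Vec.Functional using (Vector; []; _∷_)
open import Function.Base using (_∘_)
open import Relation.Binary.Bundles using (Setoid; Poset)
open import Relation.Binary.Core using (Rel)
open import Relation.Binary.Structures using (IsDecTotalOrder)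
import Relation.Binary.Construct.On as On
import Relation.Binary.Reasoning.PartialOrder as PosetReasoning
import Relation.Binary.Reasoning.Setoid as SetoidReasoning
open import Relation.Nullary using (¬_; does; yes; no)
open import Relation.Unary using (Pred; Satisfiable)

private
  variable
    c c′ o o′ o″ h h′ h″ e e′ e″ ℓ : Level

------------------------------------------------------------------------
-- Stands for the real numbers, which are the only Dedekind-complete ordered
-- field up to isomorphism.  As in classical mathematics, the order is decidable
-- and every nonempty bounded predicate has a supremum.

record CompleteOrderedField ℓ : Set (lsuc ℓ) where
  infix 4 _≤_
  field
    commutativeRing : CommutativeRing ℓ ℓ

  open CommutativeRing commutativeRing public

  field
    _≤_             : Rel Carrier ℓ
    isDecTotalOrder : IsDecTotalOrder _≈_ _≤_
    0≉1             : ¬ 0# ≈ 1#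
    inverse         : ∀ x → ¬ x ≈ 0# → ∃[ y ] x * y ≈ 1#
    +-monoˡ-≤       : ∀ z {x y} → x ≤ y → x + z ≤ y + z
    *-nonneg        : ∀ {x y} → 0# ≤ x → 0# ≤ y → 0# ≤ x * y
    supremum        : (P : Pred Carrier ℓ) → Satisfiable P →
                      (∃[ b ] ∀ x → P x → x ≤ b) →
                      ∃[ s ] (∀ x → P x → x ≤ s) ×
                             (∀ b → (∀ x → P x → x ≤ b) → s ≤ b)

  module Order = IsDecTotalOrder isDecTotalOrder

  poset : Poset ℓ ℓ ℓ
  poset = record { isPartialOrder = Order.isPartialOrder }

  open SemiringSum semiring public

------------------------------------------------------------------------
-- Dcpos.  Elements are compared by the setoid equality of the poset.
-- Directed families are indexed by types of a fixed universe ℓ, which contains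
-- the carriers of all objects below.  Only the hom-dcpos of a category of dcpos
-- have a carrier in a larger universe, since continuity quantifies over ℓ.

module _ (P : Poset c ℓ ℓ) where
  open Poset P

  record IsDirected {I : Set ℓ} (d : I → Carrier) : Set ℓ where
    field
      inhabitant : I
      bounded    : ∀ i j → ∃[ k ] d i ≤ d k × d j ≤ d k

  record IsLub {I : Set ℓ} (d : I → Carrier) (s : Carrier) : Set (c ⊔ ℓ) where
    field
      upper : ∀ i → d i ≤ s
      least : ∀ b → (∀ i → d i ≤ b) → s ≤ b

record IsScottContinuous (P : Poset c ℓ ℓ) (Q : Poset c′ ℓ ℓ)
                         (f : Poset.Carrier P → Poset.Carrier Q) : Set (c ⊔ c′ ⊔ lsuc ℓ) where
  private
    module P = Poset P
    module Q = Poset Q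
  field
    monotone     : ∀ {x y} → x P.≤ y → f x Q.≤ f y
    preservesLub : ∀ {I : Set ℓ} (d : I → P.Carrier) → IsDirected P d →
                   ∀ {s} → IsLub P d s → IsLub Q (f ∘ d) (f s)

  cong : ∀ {x y} → x P.≈ y → f x Q.≈ f y
  cong x≈y = Q.antisym (monotone (P.reflexive x≈y))
                       (monotone (P.reflexive (P.Eq.sym x≈y)))

record PointedDcpo c ℓ : Set (lsuc (c ⊔ ℓ)) where
  field
    poset : Poset c ℓ ℓ

  open Poset poset public

  field
    directedLub : ∀ {I : Set ℓ} (d : I → Carrier) → IsDirected poset d →
                  ∃[ s ] IsLub poset d s
    ⊥           : Carrier
    ⊥-least     : ∀ x → ⊥ ≤ x

  setoid : Setoid c ℓ
  setoid = record { isEquivalence = isEquivalence }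

∣_∣ : PointedDcpo c ℓ → Set c
∣ X ∣ = PointedDcpo.Carrier X

record IsStrictScottContinuous (X : PointedDcpo c ℓ) (Y : PointedDcpo c′ ℓ)
                               (f : ∣ X ∣ → ∣ Y ∣) : Set (c ⊔ c′ ⊔ lsuc ℓ) where
  private
    module X = PointedDcpo X
    module Y = PointedDcpo Y
  field
    isScottContinuous : IsScottContinuous X.poset Y.poset f
    strict            : f X.⊥ Y.≈ Y.⊥

  open IsScottContinuous isScottContinuous public

module _ (P : Poset c ℓ ℓ) where
  open Poset P

  lub-unique : ∀ {I : Set ℓ} {d : I → Carrier} {s t} →
               IsLub P d s → IsLub P d t → s ≈ t
  lub-unique s-lub t-lub = antisym
    (IsLub.least s-lub _ (IsLub.upper t-lub))
    (IsLub.least t-lub _ (IsLub.upper s-lub))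

  lub-resp : ∀ {I : Set ℓ} {d e : I → Carrier} {s t} → (∀ i → d i ≈ e i) → s ≈ t →
             IsLub P d s → IsLub P e t
  lub-resp d≈e s≈t s-lub = record
    { upper = λ i → trans (reflexive (Eq.sym (d≈e i)))
                          (trans (IsLub.upper s-lub i) (reflexive s≈t))
    ; least = λ b e≤b → trans (reflexive (Eq.sym s≈t))
                (IsLub.least s-lub b λ i → trans (reflexive (d≈e i)) (e≤b i))
    }

directed-map : ∀ (P : Poset c ℓ ℓ) (Q : Poset c′ ℓ ℓ) {f : Poset.Carrier P → Poset.Carrier Q} →
               (∀ {x y} → Poset._≤_ P x y → Poset._≤_ Q (f x) (f y)) →
               {I : Set ℓ} {d : I → Poset.Carrier P} → IsDirected P d → IsDirected Q (f ∘ d)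
directed-map P Q mono dir = record
  { inhabitant = IsDirected.inhabitant dir
  ; bounded    = λ i j → let (k , p , q) = IsDirected.bounded dir i j in k , mono p , mono q
  }

------------------------------------------------------------------------

powerPoset : Poset c ℓ ℓ → ℕ → Poset c ℓ ℓ
powerPoset P m = record
  { Carrier = Vector Carrier m
  ; _≈_ = λ x y → ∀ i → x i ≈ y i
  ; _≤_ = λ x y → ∀ i → x i ≤ y i
  ; isPartialOrder = record
    { isPreorder = record
      { isEquivalence = record
        { refl = λ _ → Eq.refl ; sym = λ p i → Eq.sym (p i) ; trans = λ p q i → Eq.trans (p i) (q i) }
      ; reflexive = λ p i → reflexive (p i)
      ; trans = λ p q i → trans (p i) (q i)
      }
    ; antisym = λ p q i → antisym (p i) (q i)
    }
  }
  where open Poset P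

power : PointedDcpo c ℓ → ℕ → PointedDcpo c ℓ
power X m = record
  { poset = powerPoset X.poset m
  ; directedLub = λ d dir →
      let lubs = λ i → X.directedLub (λ k → d k i)
                         (directed-map (powerPoset X.poset m) X.poset (λ p → p i) dir)
      in (λ i → proj₁ (lubs i)) , record
           { upper = λ k i → IsLub.upper (proj₂ (lubs i)) k
           ; least = λ b d≤b i → IsLub.least (proj₂ (lubs i)) (b i) (λ k → d≤b k i)
           }
  ; ⊥ = λ _ → X.⊥
  ; ⊥-least = λ x i → X.⊥-least (x i)
  }
  where module X = PointedDcpo X

power-lub⁺ : ∀ (P : Poset c ℓ ℓ) {m} {I : Set ℓ} {d : I → Fin m → Poset.Carrier P} {s} →
             (∀ i → IsLub P (λ k → d k i) (s i)) → IsLub (powerPoset P m) d s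
power-lub⁺ P lubs = record
  { upper = λ k i → IsLub.upper (lubs i) k
  ; least = λ b d≤b i → IsLub.least (lubs i) (b i) (λ k → d≤b k i)
  }

power-lub⁻ : ∀ (X : PointedDcpo c ℓ) {m} {I : Set ℓ} {d : I → Fin m → ∣ X ∣} {s} →
             IsDirected (PointedDcpo.poset (power X m)) d →
             IsLub (PointedDcpo.poset (power X m)) d s →
             ∀ i → IsLub (PointedDcpo.poset X) (λ k → d k i) (s i)
power-lub⁻ X {m} {d = d} {s} dir s-lub i =
  lub-resp X.poset (λ _ → X.Eq.refl) (lub-unique X^m.poset (power-lub⁺ X.poset lubs) s-lub i) (lubs i)
  where
  module X = PointedDcpo X
  module X^m = PointedDcpo (power X m)
  lubs : ∀ i → IsLub X.poset (λ k → d k i) _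
  lubs i = proj₂ (X.directedLub (λ k → d k i) (directed-map X^m.poset X.poset (λ p → p i) dir))

------------------------------------------------------------------------

record Category o h e : Set (lsuc (o ⊔ h ⊔ e)) where
  infix  4 _≈_
  infixr 9 _∙_
  field
    Obj : Set o
    Hom : Obj → Obj → Setoid h e

  _⇒_ : Obj → Obj → Set h
  A ⇒ B = Setoid.Carrier (Hom A B)

  _≈_ : ∀ {A B} → Rel (A ⇒ B) e
  _≈_ {A} {B} = Setoid._≈_ (Hom A B)

  field
    id     : ∀ {A} → A ⇒ A
    _∙_    : ∀ {A B C} → B ⇒ C → A ⇒ B → A ⇒ C
    ∙-cong : ∀ {A B C} {g g′ : B ⇒ C} {f f′ : A ⇒ B} → g ≈ g′ → f ≈ f′ → g ∙ f ≈ g′ ∙ f′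
    idˡ    : ∀ {A B} (f : A ⇒ B) → id ∙ f ≈ f
    idʳ    : ∀ {A B} (f : A ⇒ B) → f ∙ id ≈ f
    assoc  : ∀ {A B C D} (h : C ⇒ D) (g : B ⇒ C) (f : A ⇒ B) → (h ∙ g) ∙ f ≈ h ∙ (g ∙ f)

  module Eq {A B} = Setoid (Hom A B)

record Functor (C : Category o h e) (D : Category o′ h′ e′) : Set (o ⊔ h ⊔ e ⊔ o′ ⊔ h′ ⊔ e′) where
  private
    module C = Category C
    module D = Category D
  field
    F₀      : C.Obj → D.Obj
    F₁      : ∀ {A B} → A C.⇒ B → F₀ A D.⇒ F₀ B
    F₁-cong : ∀ {A B} {f g : A C.⇒ B} → f C.≈ g → F₁ f D.≈ F₁ g
    F₁-id   : ∀ {A} → F₁ (C.id {A}) D.≈ D.id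
    F₁-∙    : ∀ {A B X} (g : B C.⇒ X) (f : A C.⇒ B) → F₁ (g C.∙ f) D.≈ F₁ g D.∙ F₁ f

idFunctor : (C : Category o h e) → Functor C C
idFunctor C = record
  { F₀ = λ A → A ; F₁ = λ f → f ; F₁-cong = λ p → p ; F₁-id = Eq.refl ; F₁-∙ = λ _ _ → Eq.refl }
  where open Category C

_∘F_ : {C : Category o h e} {D : Category o′ h′ e′} {E : Category o″ h″ e″} →
       Functor D E → Functor C D → Functor C E
_∘F_ {E = E} G F = record
  { F₀ = λ A → G.F₀ (F.F₀ A)
  ; F₁ = λ f → G.F₁ (F.F₁ f)
  ; F₁-cong = λ p → G.F₁-cong (F.F₁-cong p)
  ; F₁-id = E.Eq.trans (G.F₁-cong F.F₁-id) G.F₁-id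
  ; F₁-∙ = λ g f → E.Eq.trans (G.F₁-cong (F.F₁-∙ g f)) (G.F₁-∙ _ _)
  }
  where
  module E = Category E
  module F = Functor F
  module G = Functor G

record NaturalTransformation {C : Category o h e} {D : Category o′ h′ e′}
                             (F G : Functor C D) : Set (o ⊔ h ⊔ h′ ⊔ e′) where
  private
    module C = Category C
    module D = Category D
    module F = Functor F
    module G = Functor G
  field
    component : ∀ A → F.F₀ A D.⇒ G.F₀ A
    natural   : ∀ {A B} (f : A C.⇒ B) → component B D.∙ F.F₁ f D.≈ G.F₁ f D.∙ component A

functorCategory : Category o h e → Category o′ h′ e′ →
                  Category (o ⊔ h ⊔ e ⊔ o′ ⊔ h′ ⊔ e′) (o ⊔ h ⊔ h′ ⊔ e′) (o ⊔ e′)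
functorCategory C D = record
  { Obj = Functor C D
  ; Hom = λ F G → record
    { Carrier = NaturalTransformation F G
    ; _≈_ = λ α β → ∀ A → component α A ≈ component β A
    ; isEquivalence = record
      { refl = λ _ → Eq.refl ; sym = λ p A → Eq.sym (p A) ; trans = λ p q A → Eq.trans (p A) (q A) }
    }
  ; id = record { component = λ _ → id ; natural = λ _ → Eq.trans (idˡ _) (Eq.sym (idʳ _)) }
  ; _∙_ = λ β α → record
    { component = λ A → component β A ∙ component α A
    ; natural = λ f → Eq.trans (assoc _ _ _)
        (Eq.trans (∙-cong Eq.refl (natural α f))
        (Eq.trans (Eq.sym (assoc _ _ _))
        (Eq.trans (∙-cong (natural β f) Eq.refl) (assoc _ _ _))))
    }
  ; ∙-cong = λ p q A → ∙-cong (p A) (q A)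
  ; idˡ = λ _ _ → idˡ _
  ; idʳ = λ _ _ → idʳ _
  ; assoc = λ _ _ _ _ → assoc _ _ _
  }
  where
  open Category D
  open NaturalTransformation

fullSubcategory : (C : Category o h e) {A : Set o′} → (A → Category.Obj C) → Category o′ h e
fullSubcategory C {A} U = record
  { Obj = A ; Hom = λ X Y → Hom (U X) (U Y) ; id = id ; _∙_ = _∙_ ; ∙-cong = ∙-cong
  ; idˡ = idˡ ; idʳ = idʳ ; assoc = assoc }
  where open Category C

record Iso (C : Category o h e) (A B : Category.Obj C) : Set (h ⊔ e) where
  open Category C
  field
    to      : A ⇒ B
    from    : B ⇒ A
    from∙to : from ∙ to ≈ id
    to∙from : to ∙ from ≈ id

record Equivalence (C : Category o h e) (D : Category o′ h′ e′) :
                   Set (o ⊔ h ⊔ e ⊔ o′ ⊔ h′ ⊔ e′) where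
  field
    F      : Functor C D
    G      : Functor D C
    unit   : Iso (functorCategory C C) (idFunctor C) (G ∘F F)
    counit : Iso (functorCategory D D) (F ∘F G) (idFunctor D)

module _ (C : Category o h e) where
  open Category C

  IsProduct : ∀ {k} (A : Fin k → Obj) (P : Obj) → (∀ i → P ⇒ A i) → Set (o ⊔ h ⊔ e)
  IsProduct A P π = ∀ {Y} (f : ∀ i → Y ⇒ A i) →
    Σ[ u ∈ Y ⇒ P ] (∀ i → π i ∙ u ≈ f i) ×
                   (∀ v → (∀ i → π i ∙ v ≈ f i) → v ≈ u)

PreservesFiniteProducts : {C : Category o h e} {D : Category o′ h′ e′} →
                          Functor C D → Set (o ⊔ h ⊔ e ⊔ o′ ⊔ h′ ⊔ e′)
PreservesFiniteProducts {C = C} {D} F =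
  ∀ {k} (A : Fin k → C.Obj) (P : C.Obj) (π : ∀ i → P C.⇒ A i) →
  IsProduct C A P π → IsProduct D (λ i → F₀ (A i)) (F₀ P) (λ i → F₁ (π i))
  where
  module C = Category C
  open Functor F

------------------------------------------------------------------------
-- Categories enriched in pointed dcpos and strict Scott-continuous maps.
-- Enrichment is with respect to the smash product, i.e. composition is
-- strict and Scott-continuous in each argument separately.

record EnrichedCategory o c ℓ : Set (lsuc (o ⊔ c ⊔ ℓ)) where
  infixr 9 _∙_
  field
    Obj : Set o
    Hom : Obj → Obj → PointedDcpo c ℓ

  _⇒_ : Obj → Obj → Set c
  A ⇒ B = ∣ Hom A B ∣

  private
    _≈_ : ∀ {A B} → Rel (A ⇒ B) ℓ
    _≈_ {A} {B} = PointedDcpo._≈_ (Hom A B)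

  field
    id            : ∀ {A} → A ⇒ A
    _∙_           : ∀ {A B C} → B ⇒ C → A ⇒ B → A ⇒ C
    ∙-continuousˡ : ∀ {A B C} (f : A ⇒ B) →
                    IsStrictScottContinuous (Hom B C) (Hom A C) (λ g → g ∙ f)
    ∙-continuousʳ : ∀ {A B C} (g : B ⇒ C) →
                    IsStrictScottContinuous (Hom A B) (Hom A C) (λ f → g ∙ f)
    idˡ           : ∀ {A B} (f : A ⇒ B) → (id ∙ f) ≈ f
    idʳ           : ∀ {A B} (f : A ⇒ B) → (f ∙ id) ≈ f
    assoc         : ∀ {A B C D} (h : C ⇒ D) (g : B ⇒ C) (f : A ⇒ B) →
                    ((h ∙ g) ∙ f) ≈ (h ∙ (g ∙ f))

  category : Category o c ℓ
  category = record
    { Obj = Obj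
    ; Hom = λ A B → PointedDcpo.setoid (Hom A B)
    ; id = id
    ; _∙_ = _∙_
    ; ∙-cong = λ {A} {_} {C} {_} {g′} {f} p q → PointedDcpo.Eq.trans (Hom A C)
        (IsStrictScottContinuous.cong (∙-continuousˡ f) p)
        (IsStrictScottContinuous.cong (∙-continuousʳ g′) q)
    ; idˡ = idˡ
    ; idʳ = idʳ
    ; assoc = assoc
    }

module _ {C : EnrichedCategory o c ℓ} {D : EnrichedCategory o′ c′ ℓ} where
  private
    module C = EnrichedCategory C
    module D = EnrichedCategory D

  LocallyStrictScottContinuous : Functor C.category D.category → Set (o ⊔ c ⊔ c′ ⊔ lsuc ℓ)
  LocallyStrictScottContinuous F =
    ∀ A B → IsStrictScottContinuous (C.Hom A B) (D.Hom (F₀ A) (F₀ B)) F₁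
    where open Functor F

------------------------------------------------------------------------

record StrictMap (X Y : PointedDcpo ℓ ℓ) : Set (lsuc ℓ) where
  field
    apply                   : ∣ X ∣ → ∣ Y ∣
    isStrictScottContinuous : IsStrictScottContinuous X Y apply

  open IsStrictScottContinuous isStrictScottContinuous public

open StrictMap

module _ (X Y : PointedDcpo ℓ ℓ) where
  private
    module X = PointedDcpo X
    module Y = PointedDcpo Y

  strictMapPoset : Poset (lsuc ℓ) ℓ ℓ
  strictMapPoset = record
    { Carrier = StrictMap X Y
    ; _≈_ = λ f g → ∀ x → apply f x Y.≈ apply g x
    ; _≤_ = λ f g → ∀ x → apply f x Y.≤ apply g x
    ; isPartialOrder = record
      { isPreorder = record
        { isEquivalence = record
          { refl = λ _ → Y.Eq.refl
          ; sym = λ p x → Y.Eq.sym (p x)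
          ; trans = λ p q x → Y.Eq.trans (p x) (q x)
          }
        ; reflexive = λ p x → Y.reflexive (p x)
        ; trans = λ p q x → Y.trans (p x) (q x)
        }
      ; antisym = λ p q x → Y.antisym (p x) (q x)
      }
    }

  module _ {I : Set ℓ} (d : I → StrictMap X Y) (dir : IsDirected strictMapPoset d) where
    private
      at : ∀ x → IsDirected Y.poset (λ i → apply (d i) x)
      at x = directed-map strictMapPoset Y.poset {λ f → apply f x} (λ p → p x) dir

      lubAt : ∀ x → ∃[ s ] IsLub Y.poset (λ i → apply (d i) x) s
      lubAt x = Y.directedLub (λ i → apply (d i) x) (at x)

      s : ∣ X ∣ → ∣ Y ∣
      s x = proj₁ (lubAt x)

      upper : ∀ i x → apply (d i) x Y.≤ s x
      upper i x = IsLub.upper (proj₂ (lubAt x)) i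

      least : ∀ x b → (∀ i → apply (d i) x Y.≤ b) → s x Y.≤ b
      least x = IsLub.least (proj₂ (lubAt x))

      s-mono : ∀ {x y} → x X.≤ y → s x Y.≤ s y
      s-mono {x} {y} p = least x _ λ i → Y.trans (monotone (d i) p) (upper i y)

    strictMapSup : StrictMap X Y
    strictMapSup = record
      { apply = s
      ; isStrictScottContinuous = record
        { isScottContinuous = record
          { monotone = s-mono
          ; preservesLub = λ e e-dir {t} t-lub → record
            { upper = λ j → s-mono (IsLub.upper t-lub j)
            ; least = λ b e≤b → least t b λ i →
                IsLub.least (preservesLub (d i) e e-dir t-lub) b
                  λ j → Y.trans (upper i (e j)) (e≤b j)
            }
          }
        ; strict = Y.antisym (least _ _ λ i → Y.reflexive (strict (d i))) (Y.⊥-least _)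
        }
      }

    strictMapSup-pointwise : ∀ x → IsLub Y.poset (λ i → apply (d i) x) (apply strictMapSup x)
    strictMapSup-pointwise x = proj₂ (lubAt x)

    strictMapSup-isLub : IsLub strictMapPoset d strictMapSup
    strictMapSup-isLub = record
      { upper = upper
      ; least = λ b d≤b x → least x _ λ i → d≤b i x
      }

  strictMapDcpo : PointedDcpo (lsuc ℓ) ℓ
  strictMapDcpo = record
    { poset = strictMapPoset
    ; directedLub = λ d dir → strictMapSup d dir , strictMapSup-isLub d dir
    ; ⊥ = record
      { apply = λ _ → Y.⊥
      ; isStrictScottContinuous = record
        { isScottContinuous = record
          { monotone = λ _ → Y.refl
          ; preservesLub = λ _ dir _ → record
            { upper = λ _ → Y.refl
            ; least = λ _ p → p (IsDirected.inhabitant dir)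
            }
          }
        ; strict = Y.Eq.refl
        }
      }
    ; ⊥-least = λ _ _ → Y.⊥-least _
    }

  strictMap-lub⁻ : ∀ {I : Set ℓ} {d : I → StrictMap X Y} {s} →
                   IsDirected strictMapPoset d → IsLub strictMapPoset d s →
                   ∀ x → IsLub Y.poset (λ i → apply (d i) x) (apply s x)
  strictMap-lub⁻ {d = d} dir s-lub x = lub-resp Y.poset (λ _ → Y.Eq.refl)
    (lub-unique strictMapPoset (strictMapSup-isLub d dir) s-lub x)
    (strictMapSup-pointwise d dir x)

Dcpo⊥! : ∀ ℓ → EnrichedCategory (lsuc ℓ) (lsuc ℓ) ℓ
Dcpo⊥! ℓ = record
  { Obj = PointedDcpo ℓ ℓ
  ; Hom = strictMapDcpo
  ; id = λ {X} → record
    { apply = λ x → x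
    ; isStrictScottContinuous = record
      { isScottContinuous = record { monotone = λ p → p ; preservesLub = λ _ _ p → p }
      ; strict = Eq.refl X
      }
    }
  ; _∙_ = comp
  ; ∙-continuousˡ = λ {X} {Y} {Z} f → record
    { isScottContinuous = record
      { monotone = λ p x → p (apply f x)
      ; preservesLub = λ d dir s-lub →
          pointwise X Z (λ i → comp (d i) f) λ x → strictMap-lub⁻ Y Z dir s-lub (apply f x)
      }
    ; strict = λ _ → Eq.refl Z
    }
  ; ∙-continuousʳ = λ {X} {Y} {Z} g → record
    { isScottContinuous = record
      { monotone = λ p x → monotone g (p x)
      ; preservesLub = λ d dir s-lub →
          pointwise X Z (λ i → comp g (d i)) λ x →
            preservesLub g (λ i → apply (d i) x)
              (directed-map (strictMapPoset X Y) (poset Y) {λ f → apply f x} (λ p → p x) dir)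
              (strictMap-lub⁻ X Y dir s-lub x)
      }
    ; strict = λ _ → strict g
    }
  ; idˡ = λ {_} {Y} _ _ → Eq.refl Y
  ; idʳ = λ {_} {Y} _ _ → Eq.refl Y
  ; assoc = λ {_} {_} {_} {W} _ _ _ _ → Eq.refl W
  }
  where
  open PointedDcpo
  comp : {X Y Z : PointedDcpo ℓ ℓ} → StrictMap Y Z → StrictMap X Y → StrictMap X Z
  comp {X} {Y} {Z} g f = record
    { apply = apply g ∘ apply f
    ; isStrictScottContinuous = record
      { isScottContinuous = record
        { monotone = λ p → monotone g (monotone f p)
        ; preservesLub = λ d dir s-lub →
            preservesLub g (apply f ∘ d)
              (directed-map (poset X) (poset Y) (monotone f) dir)
              (preservesLub f d dir s-lub)
        }
      ; strict = Eq.trans Z (cong g (strict f)) (strict g)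
      }
    }
  pointwise : (X Y : PointedDcpo ℓ ℓ) {I : Set ℓ} (d : I → StrictMap X Y) {s : StrictMap X Y} →
              (∀ x → IsLub (poset Y) (λ i → apply (d i) x) (apply s x)) →
              IsLub (strictMapPoset X Y) d s
  pointwise X Y d lubs = record
    { upper = λ i x → IsLub.upper (lubs x) i
    ; least = λ b d≤b x → IsLub.least (lubs x) _ λ i → d≤b i x
    }

------------------------------------------------------------------------

module _ (ℝ : CompleteOrderedField ℓ) where
  open CompleteOrderedField ℝ hiding (zero)
  private
    module ≤-Reasoning = PosetReasoning poset
    module ≈-Reasoning = SetoidReasoning setoid
    open RingProperties ring using (-‿distribˡ-*; -‿distribʳ-*; -‿involutive)

  ----------------------------------------------------------------------

  +-mono-≤ : ∀ {x y u v} → x ≤ y → u ≤ v → x + u ≤ y + v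
  +-mono-≤ {x} {y} {u} {v} p q = begin
    x + u ≤⟨ +-monoˡ-≤ u p ⟩
    y + u ≈⟨ +-comm y u ⟩
    u + y ≤⟨ +-monoˡ-≤ y q ⟩
    v + y ≈⟨ +-comm v y ⟩
    y + v ∎
    where open ≤-Reasoning

  x+y-y≈x : ∀ x y → (x + y) - y ≈ x
  x+y-y≈x x y = trans (+-assoc x y (- y)) (trans (+-congˡ (-‿inverseʳ y)) (+-identityʳ x))

  x-y+y≈x : ∀ x y → (x - y) + y ≈ x
  x-y+y≈x x y = trans (+-assoc x (- y) y) (trans (+-congˡ (-‿inverseˡ y)) (+-identityʳ x))

  x+y≤z⇒x≤z-y : ∀ {x y z} → x + y ≤ z → x ≤ z - y
  x+y≤z⇒x≤z-y {x} {y} {z} p = begin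
    x           ≈⟨ x+y-y≈x x y ⟨
    (x + y) - y ≤⟨ +-monoˡ-≤ (- y) p ⟩
    z - y       ∎
    where open ≤-Reasoning

  x≤z-y⇒x+y≤z : ∀ {x y z} → x ≤ z - y → x + y ≤ z
  x≤z-y⇒x+y≤z {x} {y} {z} p = begin
    x + y       ≤⟨ +-monoˡ-≤ y p ⟩
    (z - y) + y ≈⟨ x-y+y≈x z y ⟩
    z           ∎
    where open ≤-Reasoning

  x≤y⇒0≤y-x : ∀ {x y} → x ≤ y → 0# ≤ y - x
  x≤y⇒0≤y-x p = x+y≤z⇒x≤z-y (Order.≤-respˡ-≈ (sym (+-identityˡ _)) p)

  0≤y-x⇒x≤y : ∀ {x y} → 0# ≤ y - x → x ≤ y
  0≤y-x⇒x≤y p = Order.≤-respˡ-≈ (+-identityˡ _) (x≤z-y⇒x+y≤z p)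

  *-monoʳ-≤ : ∀ {a x y} → 0# ≤ a → x ≤ y → a * x ≤ a * y
  *-monoʳ-≤ {a} {x} {y} 0≤a x≤y = 0≤y-x⇒x≤y (begin
    0#             ≤⟨ *-nonneg 0≤a (x≤y⇒0≤y-x x≤y) ⟩
    a * (y - x)    ≈⟨ distribˡ a y (- x) ⟩
    a * y + a * - x ≈⟨ +-congˡ (-‿distribʳ-* a x) ⟨
    a * y - a * x  ∎)
    where open ≤-Reasoning

  *-monoˡ-≤ : ∀ {a x y} → 0# ≤ a → x ≤ y → x * a ≤ y * a
  *-monoˡ-≤ 0≤a x≤y =
    Order.≤-respʳ-≈ (*-comm _ _) (Order.≤-respˡ-≈ (*-comm _ _) (*-monoʳ-≤ 0≤a x≤y))

  0≤1 : 0# ≤ 1#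
  0≤1 with Order.total 0# 1#
  ... | inj₁ p = p
  ... | inj₂ 1≤0 = begin
    0#            ≤⟨ *-nonneg 0≤-1 0≤-1 ⟩
    - 1# * - 1#   ≈⟨ -‿distribˡ-* 1# (- 1#) ⟨
    - (1# * - 1#) ≈⟨ -‿cong (*-identityˡ (- 1#)) ⟩
    - (- 1#)      ≈⟨ -‿involutive 1# ⟩
    1#            ∎
    where
    open ≤-Reasoning
    0≤-1 : 0# ≤ - 1#
    0≤-1 = Order.≤-respʳ-≈ (+-identityˡ _) (x≤y⇒0≤y-x 1≤0)

  inverse-nonneg : ∀ {a b} → 0# ≤ a → a * b ≈ 1# → 0# ≤ b
  inverse-nonneg {a} {b} 0≤a ab≈1 with Order.total 0# b
  ... | inj₁ p = p
  ... | inj₂ b≤0 = ⊥-elim (0≉1 (Order.antisym 0≤1 (begin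
    1#     ≈⟨ ab≈1 ⟨
    a * b  ≤⟨ *-monoʳ-≤ 0≤a b≤0 ⟩
    a * 0# ≈⟨ zeroʳ a ⟩
    0#     ∎)))
    where open ≤-Reasoning

  sum-mono : ∀ {n} {x y : Vector Carrier n} → (∀ i → x i ≤ y i) → sum x ≤ sum y
  sum-mono {zero}  p = Order.refl
  sum-mono {suc n} p = +-mono-≤ (p zero) (sum-mono (p ∘ suc))

  sum-zero : ∀ {n} {x : Vector Carrier n} → (∀ i → x i ≈ 0#) → sum x ≈ 0#
  sum-zero {n} p = trans (sum-cong-≋ p) (sum-replicate-zero n)

  sum-nonneg : ∀ {n} {x : Vector Carrier n} → (∀ i → 0# ≤ x i) → 0# ≤ sum x
  sum-nonneg {n} p = Order.≤-respˡ-≈ (sum-zero {n} λ _ → refl) (sum-mono {n} p)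

  δ : ∀ {n} → Fin n → Fin n → Carrier
  δ i j = if does (i ≟ j) then 1# else 0#

  δ-nonneg : ∀ {n} (i j : Fin n) → 0# ≤ δ i j
  δ-nonneg i j with does (i ≟ j)
  ... | Bool.true  = 0≤1
  ... | Bool.false = Order.refl

  δ-sym : ∀ {n} (i j : Fin n) → δ i j ≈ δ j i
  δ-sym zero    zero    = refl
  δ-sym zero    (suc j) = refl
  δ-sym (suc i) zero    = refl
  δ-sym (suc i) (suc j) = δ-sym i j

  sum-δˡ : ∀ {n} (i : Fin n) (x : Vector Carrier n) → ∑[ j < n ] (δ i j * x j) ≈ x i
  sum-δˡ zero x = begin
    1# * x zero + sum (λ j → 0# * x (suc j)) ≈⟨ +-cong (*-identityˡ _) (sum-zero λ j → zeroˡ (x (suc j))) ⟩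
    x zero + 0#                              ≈⟨ +-identityʳ _ ⟩
    x zero                                   ∎
    where open ≈-Reasoning
  sum-δˡ (suc i) x = begin
    0# * x zero + sum (λ j → δ i j * x (suc j)) ≈⟨ +-cong (zeroˡ _) (sum-δˡ i (x ∘ suc)) ⟩
    0# + x (suc i)                              ≈⟨ +-identityˡ _ ⟩
    x (suc i)                                   ∎
    where open ≈-Reasoning

  sum-δʳ : ∀ {n} (i : Fin n) (x : Vector Carrier n) → ∑[ j < n ] (x j * δ j i) ≈ x i
  sum-δʳ i x = trans (sum-cong-≋ λ j → trans (*-comm (x j) (δ j i)) (*-congʳ (δ-sym j i))) (sum-δˡ i x)

  sum-δ : ∀ {n} (i : Fin n) → sum (δ i) ≈ 1#
  sum-δ i = trans (sum-cong-≋ λ j → sym (*-identityʳ (δ i j))) (sum-δˡ i λ _ → 1#)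

  mix : ∀ {m n} → Vector Carrier m → (Fin m → Vector Carrier n) → Vector Carrier n
  mix {m} r s j = ∑[ i < m ] (r i * s i j)

  mix-assoc : ∀ {k m n} (r : Vector Carrier k) (s : Fin k → Vector Carrier m)
              (t : Fin m → Vector Carrier n) →
              ∀ j → mix r (λ i → mix (s i) t) j ≈ mix (mix r s) t j
  mix-assoc {k} {m} r s t j = begin
    ∑[ i < k ] (r i * ∑[ l < m ] (s i l * t l j))   ≈⟨ sum-cong-≋ (λ i → *-distribˡ-sum (r i) (λ l → s i l * t l j)) ⟩
    ∑[ i < k ] ∑[ l < m ] (r i * (s i l * t l j))   ≈⟨ ∑-comm (λ i l → r i * (s i l * t l j)) ⟩
    ∑[ l < m ] ∑[ i < k ] (r i * (s i l * t l j))   ≈⟨ sum-cong-≋ (λ l → sum-cong-≋ λ i → sym (*-assoc (r i) (s i l) (t l j))) ⟩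
    ∑[ l < m ] ∑[ i < k ] ((r i * s i l) * t l j)   ≈⟨ sum-cong-≋ (λ l → sym (*-distribʳ-sum (t l j) λ i → r i * s i l)) ⟩
    ∑[ l < m ] (∑[ i < k ] (r i * s i l) * t l j)   ∎
    where open ≈-Reasoning

  mix-nonneg : ∀ {m n} {r : Vector Carrier m} {s : Fin m → Vector Carrier n} →
               (∀ i → 0# ≤ r i) → (∀ i j → 0# ≤ s i j) → ∀ j → 0# ≤ mix r s j
  mix-nonneg p q j = sum-nonneg λ i → *-nonneg (p i) (q i j)

  sum-mix : ∀ {m n} (r : Vector Carrier m) (s : Fin m → Vector Carrier n) →
            sum (mix r s) ≈ ∑[ i < m ] (r i * sum (s i))
  sum-mix r s = trans (∑-comm λ j i → r i * s i j)
                      (sum-cong-≋ λ i → sym (*-distribˡ-sum (r i) (s i)))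

  ----------------------------------------------------------------------

  lub-+ : ∀ {I : Set ℓ} {f g : I → Carrier} {s t} →
          (∀ i j → ∃[ k ] f i ≤ f k × g j ≤ g k) →
          IsLub poset f s → IsLub poset g t → IsLub poset (λ i → f i + g i) (s + t)
  lub-+ {f = f} {g} {s} {t} dir s-lub t-lub = record
    { upper = λ i → +-mono-≤ (IsLub.upper s-lub i) (IsLub.upper t-lub i)
    ; least = λ b p → Order.≤-respˡ-≈ (+-comm t s) (x≤z-y⇒x+y≤z
        (IsLub.least t-lub _ λ j → x+y≤z⇒x≤z-y (Order.≤-respˡ-≈ (+-comm s (g j)) (x≤z-y⇒x+y≤z
          (IsLub.least s-lub _ λ i → x+y≤z⇒x≤z-y
            (let (k , q , r) = dir i j in Order.trans (+-mono-≤ q r) (p k)))))))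
    }

  lub-sum : ∀ {I : Set ℓ} {n} {d : I → Vector Carrier n} {s : Vector Carrier n} →
            IsDirected (powerPoset poset n) d → (∀ j → IsLub poset (λ i → d i j) (s j)) →
            IsLub poset (λ i → sum (d i)) (sum s)
  lub-sum {n = zero} dir lubs = record
    { upper = λ _ → Order.refl ; least = λ _ p → p (IsDirected.inhabitant dir) }
  lub-sum {n = suc n} {d} dir lubs = lub-+
    (λ i j → let (k , p , q) = IsDirected.bounded dir i j in k , p zero , sum-mono (q ∘ suc))
    (lubs zero)
    (lub-sum (directed-map (powerPoset poset (suc n)) (powerPoset poset n) {_∘ suc} (_∘ suc) dir)
             (lubs ∘ suc))

  lub-* : ∀ {I : Set ℓ} {f : I → Carrier} {s} → I → ∀ {a} → 0# ≤ a →
          IsLub poset f s → IsLub poset (λ i → a * f i) (a * s)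
  lub-* {f = f} {s} i₀ {a} 0≤a s-lub = record
    { upper = λ i → *-monoʳ-≤ 0≤a (IsLub.upper s-lub i)
    ; least = least
    }
    where
    open ≤-Reasoning
    least : ∀ b → (∀ i → a * f i ≤ b) → a * s ≤ b
    least b p with a Order.≟ 0#
    ... | yes a≈0 = begin
      a * s     ≈⟨ *-congʳ a≈0 ⟩
      0# * s    ≈⟨ zeroˡ s ⟩
      0#        ≈⟨ zeroˡ (f i₀) ⟨
      0# * f i₀ ≈⟨ *-congʳ a≈0 ⟨
      a * f i₀  ≤⟨ p i₀ ⟩
      b         ∎
    ... | no a≉0 = begin
      a * s           ≤⟨ *-monoʳ-≤ 0≤a (IsLub.least s-lub _ below) ⟩
      a * (a⁻¹ * b)   ≈⟨ *-assoc a a⁻¹ b ⟨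
      (a * a⁻¹) * b   ≈⟨ *-congʳ aa⁻¹≈1 ⟩
      1# * b          ≈⟨ *-identityˡ b ⟩
      b               ∎
      where
      a⁻¹ = proj₁ (inverse a a≉0)
      aa⁻¹≈1 = proj₂ (inverse a a≉0)
      below : ∀ i → f i ≤ a⁻¹ * b
      below i = begin
        f i             ≈⟨ *-identityˡ (f i) ⟨
        1# * f i        ≈⟨ *-congʳ (trans (*-comm a⁻¹ a) aa⁻¹≈1) ⟨
        (a⁻¹ * a) * f i ≈⟨ *-assoc a⁻¹ a (f i) ⟩
        a⁻¹ * (a * f i) ≤⟨ *-monoʳ-≤ (inverse-nonneg 0≤a aa⁻¹≈1) (p i) ⟩
        a⁻¹ * b         ∎

  lub-exists : ∀ {I : Set ℓ} (f : I → Carrier) → I → ∀ b → (∀ i → f i ≤ b) →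
               ∃[ s ] IsLub poset f s
  lub-exists f i₀ b p =
    let (s , upper , least) = supremum (λ x → ∃[ i ] x ≈ f i) (f i₀ , i₀ , refl)
                                (b , λ { x (i , x≈fi) → Order.≤-respˡ-≈ (sym x≈fi) (p i) })
    in s , record
      { upper = λ i → upper (f i) (i , refl)
      ; least = λ c q → least c λ { x (i , x≈fi) → Order.≤-respˡ-≈ (sym x≈fi) (q i) }
      }

  ----------------------------------------------------------------------

  record Dist (n : ℕ) : Set ℓ where
    field
      weight : Vector Carrier n
      nonneg : ∀ i → 0# ≤ weight i
      sum≈1  : sum weight ≈ 1#

  -- The bound weight i ≤ 1# follows from the other conditions.
  record SubDist (n : ℕ) : Set ℓ where
    field
      weight : Vector Carrier n
      nonneg : ∀ i → 0# ≤ weight i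
      sum≤1  : sum weight ≤ 1#

  open Dist using () renaming (weight to dweight)
  open SubDist using (weight)

  dirac : ∀ {n} → Fin n → Dist n
  dirac i = record { weight = δ i ; nonneg = δ-nonneg i ; sum≈1 = sum-δ i }

  mixDist : ∀ {m n} → Dist m → (Fin m → Dist n) → Dist n
  mixDist r s = record
    { weight = mix (dweight r) (dweight ∘ s)
    ; nonneg = mix-nonneg (Dist.nonneg r) (Dist.nonneg ∘ s)
    ; sum≈1  = trans (sum-mix (dweight r) (dweight ∘ s))
        (trans (sum-cong-≋ λ i → trans (*-congˡ (Dist.sum≈1 (s i))) (*-identityʳ _)) (Dist.sum≈1 r))
    }

  mixSubDist : ∀ {m n} → SubDist m → (Fin m → SubDist n) → SubDist n
  mixSubDist {m} r s = record
    { weight = mix (weight r) (weight ∘ s)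
    ; nonneg = mix-nonneg (SubDist.nonneg r) (SubDist.nonneg ∘ s)
    ; sum≤1  = begin
        sum (mix (weight r) (weight ∘ s))            ≈⟨ sum-mix (weight r) (weight ∘ s) ⟩
        ∑[ i < m ] (weight r i * sum (weight (s i))) ≤⟨ sum-mono (λ i → *-monoʳ-≤ (SubDist.nonneg r i) (SubDist.sum≤1 (s i))) ⟩
        ∑[ i < m ] (weight r i * 1#)                 ≈⟨ sum-cong-≋ (λ i → *-identityʳ (weight r i)) ⟩
        sum (weight r)                               ≤⟨ SubDist.sum≤1 r ⟩
        1#                                           ∎
    }
    where open ≤-Reasoning

  subDist : ∀ {n} → Dist n → SubDist n
  subDist r = record
    { weight = dweight r ; nonneg = Dist.nonneg r ; sum≤1 = Order.reflexive (Dist.sum≈1 r) }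

  subDistPoset : ℕ → Poset ℓ ℓ ℓ
  subDistPoset n = record
    { Carrier = SubDist n
    ; _≈_ = λ p q → ∀ i → weight p i ≈ weight q i
    ; _≤_ = λ p q → ∀ i → weight p i ≤ weight q i
    ; isPartialOrder = record
      { isPreorder = record
        { isEquivalence = record
          { refl = λ _ → refl ; sym = λ p i → sym (p i) ; trans = λ p q i → trans (p i) (q i) }
        ; reflexive = λ p i → Order.reflexive (p i)
        ; trans = λ p q i → Order.trans (p i) (q i)
        }
      ; antisym = λ p q i → Order.antisym (p i) (q i)
      }
    }

  sum≥weight : ∀ {n} {x : Vector Carrier n} → (∀ i → 0# ≤ x i) → ∀ i → x i ≤ sum x
  sum≥weight p zero    = Order.≤-respˡ-≈ (+-identityʳ _) (+-mono-≤ Order.refl (sum-nonneg (p ∘ suc)))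
  sum≥weight p (suc i) = Order.≤-respˡ-≈ (+-identityˡ _) (+-mono-≤ (p zero) (sum≥weight (p ∘ suc) i))

  weight≤1 : ∀ {n} (p : SubDist n) i → weight p i ≤ 1#
  weight≤1 p i = Order.trans (sum≥weight (SubDist.nonneg p) i) (SubDist.sum≤1 p)

  module _ {n} {I : Set ℓ} (d : I → SubDist n) (dir : IsDirected (subDistPoset n) d) where
    private
      i₀ = IsDirected.inhabitant dir
      lubs : ∀ j → ∃[ s ] IsLub poset (λ i → weight (d i) j) s
      lubs j = lub-exists (λ i → weight (d i) j) i₀ 1# λ i → weight≤1 (d i) j

    subDistSup : SubDist n
    subDistSup = record
      { weight = proj₁ ∘ lubs
      ; nonneg = λ j → Order.trans (SubDist.nonneg (d i₀) j) (IsLub.upper (proj₂ (lubs j)) i₀)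
      ; sum≤1  = IsLub.least (lub-sum (directed-map (subDistPoset n) (powerPoset poset n) {weight} (λ p → p) dir)
                                      (proj₂ ∘ lubs))
                             1# λ i → SubDist.sum≤1 (d i)
      }

    subDistSup-pointwise : ∀ j → IsLub poset (λ i → weight (d i) j) (weight subDistSup j)
    subDistSup-pointwise j = proj₂ (lubs j)

    subDistSup-isLub : IsLub (subDistPoset n) d subDistSup
    subDistSup-isLub = record
      { upper = λ i j → IsLub.upper (proj₂ (lubs j)) i
      ; least = λ b p j → IsLub.least (proj₂ (lubs j)) _ λ i → p i j
      }

  subDistDcpo : ℕ → PointedDcpo ℓ ℓ
  subDistDcpo n = record
    { poset = subDistPoset n
    ; directedLub = λ d dir → subDistSup d dir , subDistSup-isLub d dir
    ; ⊥ = record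
      { weight = λ _ → 0#
      ; nonneg = λ _ → Order.refl
      ; sum≤1 = Order.≤-respˡ-≈ (sym (sum-zero {n} λ _ → refl)) 0≤1
      }
    ; ⊥-least = SubDist.nonneg
    }

  ----------------------------------------------------------------------
  -- An arrow n → m of 𝕃 is an m-indexed family of subprobability vectors on n,
  -- so 𝕃 is opposite to the Kleisli category of the subdistribution monad.

  module _ (n m : ℕ) where
    𝕃-hom : PointedDcpo ℓ ℓ
    𝕃-hom = power (subDistDcpo n) m

    open PointedDcpo 𝕃-hom using () renaming (Carrier to Arr; poset to Arr-poset) public

  𝕃-lub⁻ : ∀ {n m} {I : Set ℓ} {d : I → Arr n m} {s} →
           IsDirected (Arr-poset n m) d → IsLub (Arr-poset n m) d s →
           ∀ k j → IsLub poset (λ i → weight (d i k) j) (weight (s k) j)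
  𝕃-lub⁻ {n} {m} {d = d} dir s-lub k j = lub-resp poset (λ _ → refl)
    (lub-unique (subDistPoset n) (subDistSup-isLub dₖ dirₖ) (power-lub⁻ (subDistDcpo n) dir s-lub k) j)
    (subDistSup-pointwise dₖ dirₖ j)
    where
    dₖ = λ i → d i k
    dirₖ = directed-map (Arr-poset n m) (subDistPoset n) {λ f → f k} (λ p → p k) dir

  𝕃-lub⁺ : ∀ {n m} {I : Set ℓ} {d : I → Arr n m} {s} →
           (∀ k j → IsLub poset (λ i → weight (d i k) j) (weight (s k) j)) →
           IsLub (Arr-poset n m) d s
  𝕃-lub⁺ lubs = record
    { upper = λ i k j → IsLub.upper (lubs k j) i
    ; least = λ b p k j → IsLub.least (lubs k j) _ λ i → p i k j
    }

  𝕃 : EnrichedCategory 0ℓ ℓ ℓ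
  𝕃 = record
    { Obj = ℕ
    ; Hom = 𝕃-hom
    ; id = λ i → subDist (dirac i)
    ; _∙_ = comp
    ; ∙-continuousˡ = continuousˡ
    ; ∙-continuousʳ = continuousʳ
    ; idˡ = λ f k i → sum-δˡ k λ j → weight (f j) i
    ; idʳ = λ f k i → sum-δʳ i (weight (f k))
    ; assoc = λ h g f k i → sym (mix-assoc (weight (h k)) (weight ∘ g) (weight ∘ f) i)
    }
    where
    comp : ∀ {n m p} → Arr m p → Arr n m → Arr n p
    comp g f k = mixSubDist (g k) f

    monoˡ : ∀ {n m p} {g g′ : Arr m p} (f : Arr n m) → (∀ k j → weight (g k) j ≤ weight (g′ k) j) →
            ∀ k j i → weight (g k) j * weight (f j) i ≤ weight (g′ k) j * weight (f j) i
    monoˡ f p k j i = *-monoˡ-≤ (SubDist.nonneg (f j) i) (p k j)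

    monoʳ : ∀ {n m p} (g : Arr m p) {f f′ : Arr n m} → (∀ j i → weight (f j) i ≤ weight (f′ j) i) →
            ∀ k j i → weight (g k) j * weight (f j) i ≤ weight (g k) j * weight (f′ j) i
    monoʳ g p k j i = *-monoʳ-≤ (SubDist.nonneg (g k) j) (p j i)

    continuousˡ : ∀ {n m p} (f : Arr n m) →
                  IsStrictScottContinuous (𝕃-hom m p) (𝕃-hom n p) (λ g → comp g f)
    continuousˡ {n} {m} {p} f = record
      { isScottContinuous = record
        { monotone = λ {g} {g′} q k i → sum-mono λ j → monoˡ {g = g} {g′} f q k j i
        ; preservesLub = λ d dir {s} s-lub → 𝕃-lub⁺ {d = λ α → comp (d α) f} {comp s f} λ k i →
            lub-sum
              (directed-map (Arr-poset m p) (powerPoset poset m) {λ g j → weight (g k) j * weight (f j) i}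
                 (λ {g} {g′} q j → monoˡ {g = g} {g′} f q k j i) dir)
              (λ j → lub-resp poset (λ _ → *-comm _ _) (*-comm _ _)
                 (lub-* (IsDirected.inhabitant dir) (SubDist.nonneg (f j) i)
                    (𝕃-lub⁻ {d = d} {s} dir s-lub k j)))
        }
      ; strict = λ k i → sum-zero λ j → zeroˡ (weight (f j) i)
      }

    continuousʳ : ∀ {n m p} (g : Arr m p) →
                  IsStrictScottContinuous (𝕃-hom n m) (𝕃-hom n p) (λ f → comp g f)
    continuousʳ {n} {m} {p} g = record
      { isScottContinuous = record
        { monotone = λ {f} {f′} q k i → sum-mono λ j → monoʳ g {f} {f′} q k j i
        ; preservesLub = λ d dir {s} s-lub → 𝕃-lub⁺ {d = λ α → comp g (d α)} {comp g s} λ k i →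
            lub-sum
              (directed-map (Arr-poset n m) (powerPoset poset m) {λ f j → weight (g k) j * weight (f j) i}
                 (λ {f} {f′} q j → monoʳ g {f} {f′} q k j i) dir)
              (λ j → lub-* (IsDirected.inhabitant dir) (SubDist.nonneg (g k) j)
                       (𝕃-lub⁻ {d = d} {s} dir s-lub j i))
        }
      ; strict = λ k i → sum-zero λ j → zeroʳ (weight (g k) j)
      }

  ----------------------------------------------------------------------

  record Model : Set (lsuc ℓ) where
    field
      functor                      : Functor (EnrichedCategory.category 𝕃)
                                             (EnrichedCategory.category (Dcpo⊥! ℓ))
      preservesFiniteProducts      : PreservesFiniteProducts functor
      locallyStrictScottContinuous : LocallyStrictScottContinuous {C = 𝕃} {D = Dcpo⊥! ℓ} functor

  Models : Category (lsuc ℓ) (lsuc ℓ) ℓ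
  Models = fullSubcategory
    (functorCategory (EnrichedCategory.category 𝕃) (EnrichedCategory.category (Dcpo⊥! ℓ)))
    Model.functor

  ----------------------------------------------------------------------

  unitInterval : Poset ℓ ℓ ℓ
  unitInterval = record
    { Carrier = ∃[ x ] 0# ≤ x × x ≤ 1#
    ; _≈_ = λ x y → proj₁ x ≈ proj₁ y
    ; _≤_ = λ x y → proj₁ x ≤ proj₁ y
    ; isPartialOrder = On.isPartialOrder proj₁ Order.isPartialOrder
    }

  [0,1] : Set ℓ
  [0,1] = Poset.Carrier unitInterval

  binary : [0,1] → Dist 2
  binary (x , 0≤x , x≤1) = record
    { weight = x ∷ (1# - x) ∷ []
    ; nonneg = λ { zero → 0≤x ; (suc zero) → x≤y⇒0≤y-x x≤1 }
    ; sum≈1  = trans (+-congˡ (+-identityʳ _)) (trans (+-comm _ _) (x-y+y≈x 1# x))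
    }

  record ConvexStructure (X : Setoid ℓ ℓ) : Set ℓ where
    private module X = Setoid X
    field
      combine       : ∀ {m} → Dist m → Vector X.Carrier m → X.Carrier
      combine-cong  : ∀ {m} {r s : Dist m} {x y : Vector X.Carrier m} →
                      (∀ i → dweight r i ≈ dweight s i) → (∀ i → x i X.≈ y i) →
                      combine r x X.≈ combine s y
      combine-dirac : ∀ {m} (i : Fin m) (x : Vector X.Carrier m) →
                      combine (dirac i) x X.≈ x i
      combine-assoc : ∀ {m n} (r : Dist m) (s : Fin m → Dist n) (x : Vector X.Carrier n) →
                      combine r (λ i → combine (s i) x) X.≈ combine (mixDist r s) x

    _⊕[_]_ : X.Carrier → [0,1] → X.Carrier → X.Carrier
    x ⊕[ t ] y = combine (binary t) (x ∷ y ∷ [])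

  record Kegelspitze : Set (lsuc ℓ) where
    field
      pointedDcpo     : PointedDcpo ℓ ℓ

    open PointedDcpo pointedDcpo public renaming (poset to order)

    field
      convexStructure : ConvexStructure (PointedDcpo.setoid pointedDcpo)

    open ConvexStructure convexStructure public

    _·_ : [0,1] → ∣ pointedDcpo ∣ → ∣ pointedDcpo ∣
    t · x = x ⊕[ t ] ⊥

    field
      combine-continuous : ∀ {m} (r : Dist m) →
                           IsScottContinuous (powerPoset order m) order (combine r)
      ·-continuousˡ      : ∀ x → IsScottContinuous unitInterval order (λ t → t · x)
      ·-continuousʳ      : ∀ t → IsScottContinuous order order (λ x → t · x)

  IsAffine : (X Y : Kegelspitze) → (Kegelspitze.Carrier X → Kegelspitze.Carrier Y) → Set ℓ
  IsAffine X Y f = ∀ {m} (r : Dist m) (x : Vector X.Carrier m) →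
                   f (X.combine r x) Y.≈ Y.combine r (f ∘ x)
    where
    module X = Kegelspitze X
    module Y = Kegelspitze Y

  record AffineMap (X Y : Kegelspitze) : Set (lsuc ℓ) where
    field
      strictMap : StrictMap (Kegelspitze.pointedDcpo X) (Kegelspitze.pointedDcpo Y)
      affine    : IsAffine X Y (apply strictMap)

  KS : Category (lsuc ℓ) (lsuc ℓ) ℓ
  KS = record
    { Obj = Kegelspitze
    ; Hom = λ X Y → record
      { Carrier = AffineMap X Y
      ; _≈_ = λ f g → strictMap f D.≈ strictMap g
      ; isEquivalence = record { refl = λ {f} → D.Eq.refl {x = strictMap f}
                               ; sym = λ {f} {g} → D.Eq.sym {x = strictMap f} {strictMap g}
                               ; trans = λ {f} {g} {h} → D.Eq.trans {i = strictMap f} {strictMap g} {strictMap h} }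
      }
    ; id = λ {X} → record { strictMap = D.id ; affine = λ _ _ → Kegelspitze.Eq.refl X }
    ; _∙_ = λ {_} {_} {Z} g f → record
      { strictMap = strictMap g D.∙ strictMap f
      ; affine = λ r x → Kegelspitze.Eq.trans Z
          (cong (strictMap g) (affine f r x)) (affine g r (apply (strictMap f) ∘ x))
      }
    ; ∙-cong = λ {_} {_} {_} {g} {g′} {f} {f′} →
        D.∙-cong {g = strictMap g} {strictMap g′} {strictMap f} {strictMap f′}
    ; idˡ = λ f → D.idˡ (strictMap f)
    ; idʳ = λ f → D.idʳ (strictMap f)
    ; assoc = λ h g f → D.assoc (strictMap h) (strictMap g) (strictMap f)
    }
    where
    open AffineMap
    module D = Category (EnrichedCategory.category (Dcpo⊥! ℓ))

-- A Kegelspitze X has combinations Σ q i · x i for every subprobability vector q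
-- (the missing mass goes to ⊥), so n ↦ Xⁿ is a functor on 𝕃.  Conversely a model
-- M satisfies M n ≅ (M 1)ⁿ, since n is the n-fold power of 1 in 𝕃, and the arrows
-- n → 1 then act on M 1 as convex combinations.  The isomorphisms X ≅ X¹ and
-- (M 1)ⁿ ≅ M n make these constructions mutually inverse.  The analytic content is
-- that Σ q i · x i is Scott-continuous in q although a Kegelspitze only provides
-- continuity of the scalings t · x.

module Submission where

open import Level using (Level)
import Algebra.Properties.Ring as RingProperties
open import Data.Fin.Base using (Fin; zero; suc; splitAt; _↑ˡ_; _↑ʳ_)
open import Data.Fin.Properties using (splitAt-↑ˡ; splitAt-↑ʳ; splitAt⁻¹-↑ˡ; splitAt⁻¹-↑ʳ)
open import Data.Nat.Base as ℕ using (ℕ; zero; suc)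
open import Data.Product.Base using (Σ; _×_; _,_; proj₁; proj₂)
open import Data.Sum.Base using (inj₁; inj₂)
open import Data.Vec.Functional using (Vector; []; _∷_; foldr)
open import Function.Base using (_∘_)
open import Relation.Binary.Bundles using (Poset)
open import Relation.Binary.PropositionalEquality as ≡ using (_≡_)
import Relation.Binary.Reasoning.PartialOrder as PosetReasoning
import Relation.Binary.Reasoning.Setoid as SetoidReasoning
open import Relation.Nullary using (yes; no)

open import Defs

private
  variable
    c c′ c″ o o′ h h′ e e′ ℓ : Level

-- Scott-continuity

module _ {P : Poset c ℓ ℓ} {Q : Poset c′ ℓ ℓ} where
  private
    module P = Poset P
    module Q = Poset Q

  continuous-resp : ∀ {f g} → (∀ x → f x Q.≈ g x) →
                    IsScottContinuous P Q f → IsScottContinuous P Q g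
  continuous-resp f≈g f-cont = record
    { monotone = λ x≤y → Q.trans (Q.reflexive (Q.Eq.sym (f≈g _)))
                           (Q.trans (F.monotone x≤y) (Q.reflexive (f≈g _)))
    ; preservesLub = λ d dir s-lub →
        lub-resp Q (λ i → f≈g (d i)) (f≈g _) (F.preservesLub d dir s-lub)
    }
    where module F = IsScottContinuous f-cont

  continuous-const : ∀ y → IsScottContinuous P Q (λ _ → y)
  continuous-const y = record
    { monotone = λ _ → Q.refl
    ; preservesLub = λ _ dir _ → record
      { upper = λ _ → Q.refl ; least = λ _ p → p (IsDirected.inhabitant dir) }
    }

  continuous-tuple : ∀ {m} {f : P.Carrier → Vector Q.Carrier m} →
                     (∀ k → IsScottContinuous P Q (λ x → f x k)) →
                     IsScottContinuous P (powerPoset Q m) f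
  continuous-tuple f-cont = record
    { monotone = λ x≤y k → IsScottContinuous.monotone (f-cont k) x≤y
    ; preservesLub = λ d dir s-lub →
        power-lub⁺ Q λ k → IsScottContinuous.preservesLub (f-cont k) d dir s-lub
    }

continuous-∘ : {P : Poset c ℓ ℓ} {Q : Poset c′ ℓ ℓ} {R : Poset c″ ℓ ℓ} →
               ∀ {g f} → IsScottContinuous Q R g → IsScottContinuous P Q f →
               IsScottContinuous P R (g ∘ f)
continuous-∘ {P = P} {Q} {g = g} {f} g-cont f-cont = record
  { monotone = G.monotone ∘ F.monotone
  ; preservesLub = λ d dir s-lub →
      G.preservesLub (f ∘ d) (directed-map P Q F.monotone dir) (F.preservesLub d dir s-lub)
  }
  where
  module F = IsScottContinuous f-cont
  module G = IsScottContinuous g-cont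

continuous-lookup : (X : PointedDcpo c ℓ) → ∀ {m} (k : Fin m) →
                    IsScottContinuous (powerPoset (PointedDcpo.poset X) m) (PointedDcpo.poset X)
                                      (λ x → x k)
continuous-lookup X k = record
  { monotone = λ p → p k
  ; preservesLub = λ d dir s-lub → power-lub⁻ X dir s-lub k
  }

module _ (X : PointedDcpo ℓ ℓ) where
  lookupMap : ∀ {m} → Fin m → StrictMap (power X m) X
  lookupMap k = record
    { apply = λ x → x k
    ; isStrictScottContinuous = record
      { isScottContinuous = continuous-lookup X k ; strict = PointedDcpo.Eq.refl X }
    }

module _ {X Y : PointedDcpo ℓ ℓ} where
  open StrictMap

  tupleMap : ∀ {m} → (Fin m → StrictMap X Y) → StrictMap X (power Y m)
  tupleMap f = record
    { apply = λ x k → apply (f k) x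
    ; isStrictScottContinuous = record
      { isScottContinuous = continuous-tuple (isScottContinuous ∘ f)
      ; strict = strict ∘ f
      }
    }

-- Categories

-- The inverses are automatically natural: composing the naturality square of `α` with `β` on both
-- sides gives the square for `β`.
pointwiseIso : {C : Category o h e} {D : Category o′ h′ e′} {F G : Functor C D}
               (α : NaturalTransformation F G) →
               (∀ A → Σ (Category._⇒_ D (Functor.F₀ G A) (Functor.F₀ F A)) λ β →
                      Category._≈_ D (Category._∙_ D β (NaturalTransformation.component α A))
                                     (Category.id D) ×
                      Category._≈_ D (Category._∙_ D (NaturalTransformation.component α A) β)
                                     (Category.id D)) →
               Iso (functorCategory C D) F G
pointwiseIso {D = D} {F} {G} α inv = record
  { to = α
  ; from = record { component = β ; natural = β-natural }
  ; from∙to = λ A → proj₁ (proj₂ (inv A))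
  ; to∙from = λ A → proj₂ (proj₂ (inv A))
  }
  where
  open Category D
  open NaturalTransformation α
  module F = Functor F
  module G = Functor G
  β = λ A → proj₁ (inv A)
  β-natural : ∀ {A B} f → β B ∙ G.F₁ f ≈ F.F₁ f ∙ β A
  β-natural {A} {B} f = begin
    β B ∙ G.F₁ f                         ≈⟨ ∙-cong Eq.refl (idʳ _) ⟨
    β B ∙ (G.F₁ f ∙ id)                  ≈⟨ ∙-cong Eq.refl (∙-cong Eq.refl (proj₂ (proj₂ (inv A)))) ⟨
    β B ∙ (G.F₁ f ∙ (component A ∙ β A)) ≈⟨ ∙-cong Eq.refl (assoc _ _ _) ⟨
    β B ∙ ((G.F₁ f ∙ component A) ∙ β A) ≈⟨ ∙-cong Eq.refl (∙-cong (natural f) Eq.refl) ⟨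
    β B ∙ ((component B ∙ F.F₁ f) ∙ β A) ≈⟨ ∙-cong Eq.refl (assoc _ _ _) ⟩
    β B ∙ (component B ∙ (F.F₁ f ∙ β A)) ≈⟨ assoc _ _ _ ⟨
    (β B ∙ component B) ∙ (F.F₁ f ∙ β A) ≈⟨ ∙-cong (proj₁ (proj₂ (inv B))) Eq.refl ⟩
    id ∙ (F.F₁ f ∙ β A)                  ≈⟨ idˡ _ ⟩
    F.F₁ f ∙ β A                         ∎
    where open SetoidReasoning (Hom _ _)

-- If F sends one cone (S , p) to a product, it preserves every product cone
-- (P , π) that factors through p: the factorisation w becomes invertible.
module _ {C : Category o h e} {D : Category o′ h′ e′} (F : Functor C D) where
  private
    module C = Category C
    module D = Category D
  open Functor F

  preservesProduct : ∀ {k} {A : Fin k → C.Obj} {S P : C.Obj}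
                     {p : ∀ i → S C.⇒ A i} {π : ∀ i → P C.⇒ A i} (w : P C.⇒ S) →
                     (∀ i → p i C.∙ w C.≈ π i) →
                     IsProduct D (F₀ ∘ A) (F₀ S) (λ i → F₁ (p i)) →
                     IsProduct C A P π →
                     IsProduct D (F₀ ∘ A) (F₀ P) (λ i → F₁ (π i))
  preservesProduct {A = A} {S} {P} {p} {π} w pw≈π FS-product P-product {Y} f =
    F₁ u D.∙ t , commutes , unique
    where
    u : S C.⇒ P
    u = proj₁ (P-product p)

    πu≈p : ∀ i → π i C.∙ u C.≈ p i
    πu≈p = proj₁ (proj₂ (P-product p))

    -- Both `u C.∙ w` and the identity factor `π` through itself, so the universal property of `P`
    -- identifies them.
    uw≈id : u C.∙ w C.≈ C.id
    uw≈id = C.Eq.trans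
      (proj₂ (proj₂ (P-product π)) _ λ i →
        C.Eq.trans (C.Eq.sym (C.assoc _ _ _)) (C.Eq.trans (C.∙-cong (πu≈p i) C.Eq.refl) (pw≈π i)))
      (C.Eq.sym (proj₂ (proj₂ (P-product π)) _ λ i → C.idʳ _))

    t : Y D.⇒ F₀ S
    t = proj₁ (FS-product f)

    commutes : ∀ i → F₁ (π i) D.∙ (F₁ u D.∙ t) D.≈ f i
    commutes i = begin
      F₁ (π i) D.∙ (F₁ u D.∙ t) ≈⟨ D.assoc _ _ _ ⟨
      (F₁ (π i) D.∙ F₁ u) D.∙ t ≈⟨ D.∙-cong (F₁-∙ _ _) D.Eq.refl ⟨
      F₁ (π i C.∙ u) D.∙ t      ≈⟨ D.∙-cong (F₁-cong (πu≈p i)) D.Eq.refl ⟩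
      F₁ (p i) D.∙ t            ≈⟨ proj₁ (proj₂ (FS-product f)) i ⟩
      f i                       ∎
      where open SetoidReasoning (D.Hom _ _)

    project-w : ∀ v i → F₁ (p i) D.∙ (F₁ w D.∙ v) D.≈ F₁ (π i) D.∙ v
    project-w v i = begin
      F₁ (p i) D.∙ (F₁ w D.∙ v) ≈⟨ D.assoc _ _ _ ⟨
      (F₁ (p i) D.∙ F₁ w) D.∙ v ≈⟨ D.∙-cong (F₁-∙ _ _) D.Eq.refl ⟨
      F₁ (p i C.∙ w) D.∙ v      ≈⟨ D.∙-cong (F₁-cong (pw≈π i)) D.Eq.refl ⟩
      F₁ (π i) D.∙ v            ∎
      where open SetoidReasoning (D.Hom Y (F₀ (A i)))

    unique : ∀ v → (∀ i → F₁ (π i) D.∙ v D.≈ f i) → v D.≈ F₁ u D.∙ t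
    unique v πv≈f = begin
      v                        ≈⟨ D.idˡ v ⟨
      D.id D.∙ v               ≈⟨ D.∙-cong F₁-id D.Eq.refl ⟨
      F₁ C.id D.∙ v            ≈⟨ D.∙-cong (F₁-cong uw≈id) D.Eq.refl ⟨
      F₁ (u C.∙ w) D.∙ v       ≈⟨ D.∙-cong (F₁-∙ _ _) D.Eq.refl ⟩
      (F₁ u D.∙ F₁ w) D.∙ v    ≈⟨ D.assoc _ _ _ ⟩
      F₁ u D.∙ (F₁ w D.∙ v)    ≈⟨ D.∙-cong D.Eq.refl (proj₂ (proj₂ (FS-product f)) _ λ i → D.Eq.trans (project-w v i) (πv≈f i)) ⟩
      F₁ u D.∙ t               ∎
      where open SetoidReasoning (D.Hom Y (F₀ P))

-- Sums of finite ordinals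

total : ∀ {k} → Vector ℕ k → ℕ
total = foldr ℕ._+_ 0

inject : ∀ {k} (A : Vector ℕ k) i → Fin (A i) → Fin (total A)
inject A zero    a = a ↑ˡ total (A ∘ suc)
inject A (suc i) a = A zero ↑ʳ inject (A ∘ suc) i a

-- Together with `inject` this splits `Fin (total A)` into disjoint blocks `Fin (A i)`, so an arrow
-- of `𝕃` into `total A` amounts to a family of arrows into the `A i`.
locate : ∀ {k} (A : Vector ℕ k) → Fin (total A) → Σ (Fin k) (Fin ∘ A)
locate {suc k} A x with splitAt (A zero) x
... | inj₁ a = zero , a
... | inj₂ y = let (i , a) = locate (A ∘ suc) y in suc i , a

locate-inject : ∀ {k} (A : Vector ℕ k) i a → locate A (inject A i a) ≡ (i , a)
locate-inject A zero    a rewrite splitAt-↑ˡ (A zero) a (total (A ∘ suc)) = ≡.refl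
locate-inject A (suc i) a
  rewrite splitAt-↑ʳ (A zero) (total (A ∘ suc)) (inject (A ∘ suc) i a)
        | locate-inject (A ∘ suc) i a = ≡.refl

inject-locate : ∀ {k} (A : Vector ℕ k) x → let (i , a) = locate A x in inject A i a ≡ x
inject-locate {suc k} A x with splitAt (A zero) x in eq
... | inj₁ a = splitAt⁻¹-↑ˡ eq
... | inj₂ y = ≡.trans (≡.cong (A zero ↑ʳ_) (inject-locate (A ∘ suc) y)) (splitAt⁻¹-↑ʳ {A zero} eq)

-- Ratios of nonnegative reals; probability and subprobability vectors

module _ {ℓ : Level} (ℝ : CompleteOrderedField ℓ) where
  private
    module R = CompleteOrderedField ℝ
  open RingProperties R.ring using (+-cancelʳ)
  open Dist using () renaming (weight to dweight)
  open SubDist using (weight)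

  -- With the convention a / 0 = 1, the ratios of a directed family of nonnegative
  -- numbers to its supremum have supremum 1 even if the supremum is 0.
  ratio : R.Carrier → R.Carrier → R.Carrier
  ratio a b with b R.Order.≟ R.0#
  ... | yes _   = R.1#
  ... | no b≉0 = proj₁ (R.inverse b b≉0) R.* a

  module _ {b : R.Carrier} (0≤b : R.0# R.≤ b) where

    -- If `b` is zero, the bounds force `a` to vanish too, so the conventional ratio `1#` is
    -- harmless.
    *-ratio : ∀ {a} → R.0# R.≤ a → a R.≤ b → b R.* ratio a b R.≈ a
    *-ratio {a} 0≤a a≤b with b R.Order.≟ R.0#
    ... | yes b≈0 = R.trans (R.*-identityʳ b) (R.trans b≈0
                      (R.Order.antisym 0≤a (R.Order.trans a≤b (R.Order.reflexive b≈0))))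
    ... | no b≉0 = R.trans (R.sym (R.*-assoc b _ a))
                     (R.trans (R.*-congʳ (proj₂ (R.inverse b b≉0))) (R.*-identityˡ a))

    ratio-mono : ∀ {a a′} → a R.≤ a′ → ratio a b R.≤ ratio a′ b
    ratio-mono a≤a′ with b R.Order.≟ R.0#
    ... | yes _   = R.Order.refl
    ... | no b≉0 = *-monoʳ-≤ ℝ (inverse-nonneg ℝ 0≤b (proj₂ (R.inverse b b≉0))) a≤a′

    ratio-self : ratio b b R.≈ R.1#
    ratio-self with b R.Order.≟ R.0#
    ... | yes _   = R.refl
    ... | no b≉0 = R.trans (R.*-comm _ b) (proj₂ (R.inverse b b≉0))

    ratio-nonneg : ∀ {a} → R.0# R.≤ a → R.0# R.≤ ratio a b
    ratio-nonneg 0≤a with b R.Order.≟ R.0#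
    ... | yes _   = 0≤1 ℝ
    ... | no b≉0 = R.*-nonneg (inverse-nonneg ℝ 0≤b (proj₂ (R.inverse b b≉0))) 0≤a

    -- Multiplication by the inverse of a nonzero `b` preserves suprema; for zero `b` all ratios are
    -- `1#`, and `i₀` provides one of them.
    lub-ratio : ∀ {I : Set ℓ} {f : I → R.Carrier} → I → IsLub R.poset f b →
                IsLub R.poset (λ i → ratio (f i) b) R.1#
    lub-ratio {f = f} i₀ b-lub with b R.Order.≟ R.0#
    ... | yes _   = record { upper = λ _ → R.Order.refl ; least = λ _ p → p i₀ }
    ... | no b≉0 = lub-resp R.poset (λ _ → R.refl)
                     (R.trans (R.*-comm _ b) (proj₂ (R.inverse b b≉0)))
                     (lub-* ℝ i₀ (inverse-nonneg ℝ 0≤b (proj₂ (R.inverse b b≉0))) b-lub)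

    ratio-interval : ∀ {a} → R.0# R.≤ a → a R.≤ b → [0,1] ℝ
    ratio-interval {a} 0≤a a≤b =
      ratio a b , ratio-nonneg 0≤a , R.Order.≤-respʳ-≈ ratio-self (ratio-mono a≤b)

  -- The total mass is `1#`, so the first weight is determined by the others. Vectors built by
  -- `complete` are therefore compared at the original entries only.
  Dist-≈ : ∀ {n} (r s : Dist ℝ (suc n)) → (∀ i → dweight r (suc i) R.≈ dweight s (suc i)) →
           ∀ i → dweight r i R.≈ dweight s i
  Dist-≈ r s r≈s (suc i) = r≈s i
  Dist-≈ r s r≈s zero = +-cancelʳ (R.sum (dweight r ∘ suc)) _ _ (begin
    dweight r zero R.+ R.sum (dweight r ∘ suc) ≈⟨ Dist.sum≈1 r ⟩
    R.1#                                       ≈⟨ Dist.sum≈1 s ⟨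
    dweight s zero R.+ R.sum (dweight s ∘ suc) ≈⟨ R.+-congˡ (R.sum-cong-≋ r≈s) ⟨
    dweight s zero R.+ R.sum (dweight r ∘ suc) ∎)
    where open SetoidReasoning R.setoid

  -- The extra position `zero` receives the missing mass and is later filled with `⊥`.
  complete : ∀ {n} → SubDist ℝ n → Dist ℝ (suc n)
  complete q = record
    { weight = (R.1# R.- R.sum (weight q)) ∷ weight q
    ; nonneg = λ { zero → x≤y⇒0≤y-x ℝ (SubDist.sum≤1 q) ; (suc i) → SubDist.nonneg q i }
    ; sum≈1  = x-y+y≈x ℝ R.1# (R.sum (weight q))
    }

  scaledDirac : ∀ {n} → [0,1] ℝ → Fin n → SubDist ℝ n
  scaledDirac {n} (t , 0≤t , t≤1) i = record
    { weight = λ j → t R.* δ ℝ i j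
    ; nonneg = λ j → R.*-nonneg 0≤t (δ-nonneg ℝ i j)
    ; sum≤1  = begin
        R.sum (λ j → t R.* δ ℝ i j) ≈⟨ R.*-distribˡ-sum t (δ ℝ i) ⟨
        t R.* R.sum (δ ℝ i)         ≈⟨ R.*-congˡ (sum-δ ℝ i) ⟩
        t R.* R.1#                  ≈⟨ R.*-identityʳ t ⟩
        t                           ≤⟨ t≤1 ⟩
        R.1#                        ∎
    }
    where open PosetReasoning R.poset

  -- Subconvex combinations in a Kegelspitze

  module Subconvex (X : Kegelspitze ℝ) where
    open Kegelspitze X
    open SetoidReasoning setoid

    subcombine : ∀ {n} → SubDist ℝ n → Vector Carrier n → Carrier
    subcombine q x = combine (complete q) (⊥ ∷ x)

    -- Flattening by `combine-assoc` and then applying `Dist-≈` leaves only the weights outside the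
    -- `⊥` position to compare; `subcombine-dist`, `subcombine-assoc` and `·-subcombine` are
    -- instances.
    combine-⊥∷ : ∀ {m n} (r : Dist ℝ m) {y : Vector Carrier m} (s : Fin m → Dist ℝ (suc n))
                 {x : Vector Carrier n} (q : SubDist ℝ n) →
                 (∀ i → combine (s i) (⊥ ∷ x) ≈ y i) →
                 (∀ j → mix ℝ (dweight r) (dweight ∘ s) (suc j) R.≈ weight q j) →
                 combine r y ≈ subcombine q x
    combine-⊥∷ r {y} s {x} q y≈ rs≈q = begin
      combine r y                              ≈⟨ combine-cong {r = r} {r} (λ _ → R.refl) y≈ ⟨
      combine r (λ i → combine (s i) (⊥ ∷ x))  ≈⟨ combine-assoc r s (⊥ ∷ x) ⟩
      combine (mixDist ℝ r s) (⊥ ∷ x)          ≈⟨ combine-cong {r = mixDist ℝ r s} {complete q}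
                                                    (Dist-≈ (mixDist ℝ r s) (complete q) rs≈q)
                                                    (λ _ → Eq.refl) ⟩
      subcombine q x                           ∎

    subcombine-cong : ∀ {n} {q q′ : SubDist ℝ n} {x x′ : Vector Carrier n} →
                      (∀ i → weight q i R.≈ weight q′ i) → (∀ i → x i ≈ x′ i) →
                      subcombine q x ≈ subcombine q′ x′
    subcombine-cong {q = q} {q′} q≈q′ x≈x′ = combine-cong {r = complete q} {complete q′}
      (Dist-≈ (complete q) (complete q′) q≈q′)
      (λ { zero → Eq.refl ; (suc i) → x≈x′ i })

    subcombine-dist : ∀ {n} (r : Dist ℝ n) (x : Vector Carrier n) →
                      subcombine (subDist ℝ r) x ≈ combine r x
    subcombine-dist r x = Eq.sym (combine-⊥∷ r (dirac ℝ ∘ suc) (subDist ℝ r)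
      (λ i → combine-dirac (suc i) (⊥ ∷ x)) (λ j → sum-δʳ ℝ j (dweight r)))

    subcombine-dirac : ∀ {n} (i : Fin n) (x : Vector Carrier n) →
                       subcombine (subDist ℝ (dirac ℝ i)) x ≈ x i
    subcombine-dirac i x = Eq.trans (subcombine-dist (dirac ℝ i) x) (combine-dirac i x)

    subcombine-assoc : ∀ {m n} (q : SubDist ℝ m) (s : Fin m → SubDist ℝ n) (x : Vector Carrier n) →
                       subcombine q (λ i → subcombine (s i) x) ≈ subcombine (mixSubDist ℝ q s) x
    -- The outer `⊥` is the Dirac combination of `⊥ ∷ x` at `zero`, which adds nothing to the
    -- remaining weights.
    subcombine-assoc q s x = combine-⊥∷ (complete q) (dirac ℝ zero ∷ complete ∘ s) (mixSubDist ℝ q s)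
      (λ { zero → combine-dirac zero (⊥ ∷ x) ; (suc i) → Eq.refl })
      (λ j → R.trans (R.+-congʳ (R.zeroʳ _)) (R.+-identityˡ _))

    ·-subcombine : ∀ {n} (t : [0,1] ℝ) (i : Fin n) (x : Vector Carrier n) →
                   t · x i ≈ subcombine (scaledDirac t i) x
    ·-subcombine t i x = combine-⊥∷ (binary ℝ t) (dirac ℝ (suc i) ∷ dirac ℝ zero ∷ []) (scaledDirac t i)
      (λ { zero → combine-dirac (suc i) (⊥ ∷ x) ; (suc zero) → combine-dirac zero (⊥ ∷ x) })
      (λ j → R.trans (R.+-congˡ (R.trans (R.+-identityʳ _) (R.zeroʳ _))) (R.+-identityʳ _))

    -- Each `t i · x i` is a combination with weights `scaledDirac (t i) i`, so associativity
    -- multiplies `s` by a diagonal matrix with entries from `t`.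
    subcombine-· : ∀ {n} (s q : SubDist ℝ n) (t : Fin n → [0,1] ℝ) (x : Vector Carrier n) →
                   (∀ j → weight s j R.* proj₁ (t j) R.≈ weight q j) →
                   subcombine s (λ i → t i · x i) ≈ subcombine q x
    subcombine-· {n} s q t x st≈q = begin
      subcombine s (λ i → t i · x i)          ≈⟨ subcombine-cong {q = s} {s} (λ _ → R.refl) (λ i → ·-subcombine (t i) i x) ⟩
      subcombine s (λ i → subcombine (d i) x) ≈⟨ subcombine-assoc s d x ⟩
      subcombine (mixSubDist ℝ s d) x         ≈⟨ subcombine-cong {q = mixSubDist ℝ s d} {q} weights (λ _ → Eq.refl) ⟩
      subcombine q x                          ∎
      where
      d : Fin n → SubDist ℝ n
      d i = scaledDirac (t i) i

      weights : ∀ j → R.sum (λ i → weight s i R.* (proj₁ (t i) R.* δ ℝ i j)) R.≈ weight q j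
      weights j = R.trans (R.sum-cong-≋ {n} λ i → R.sym (R.*-assoc (weight s i) (proj₁ (t i)) (δ ℝ i j)))
        (R.trans (sum-δʳ ℝ j (λ i → weight s i R.* proj₁ (t i))) (st≈q j))

    one : [0,1] ℝ
    one = R.1# , 0≤1 ℝ , R.Order.refl

    1·x≈x : ∀ x → one · x ≈ x
    1·x≈x x = Eq.trans
      (combine-cong {r = binary ℝ one} {dirac ℝ zero} {x ∷ ⊥ ∷ []} weights (λ _ → Eq.refl))
      (combine-dirac zero (x ∷ ⊥ ∷ []))
      where
      weights : ∀ i → dweight (binary ℝ one) i R.≈ δ ℝ zero i
      weights zero       = R.refl
      weights (suc zero) = R.-‿inverseʳ R.1#

    subcombine-continuousʳ : ∀ {n} (q : SubDist ℝ n) →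
      IsStrictScottContinuous (power pointedDcpo n) pointedDcpo (subcombine q)
    subcombine-continuousʳ {n} q = record
      { isScottContinuous = continuous-∘ (combine-continuous (complete q))
          (continuous-tuple λ { zero → continuous-const ⊥
                              ; (suc i) → continuous-lookup pointedDcpo i })
      -- Every entry `⊥` is a Dirac combination of the one-point vector `b`; by associativity the
      -- whole becomes a combination of `b`, and the only probability vector on one point is Dirac.
      ; strict = begin
          subcombine q (λ _ → ⊥)                                ≈⟨ combine-cong {r = complete q} {complete q} (λ _ → R.refl) bs ⟨
          combine (complete q) (λ _ → combine (dirac ℝ zero) b) ≈⟨ combine-assoc (complete q) (λ _ → dirac ℝ zero) b ⟩
          combine r b                                           ≈⟨ combine-cong {r = r} {dirac ℝ zero} (Dist-≈ r (dirac ℝ zero) λ ()) (λ _ → Eq.refl) ⟩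
          combine (dirac ℝ zero) b                              ≈⟨ combine-dirac zero b ⟩
          ⊥                                                     ∎
      }
      where
      b : Vector Carrier 1
      b _ = ⊥

      bs : ∀ i → combine (dirac ℝ zero) b ≈ (⊥ ∷ λ _ → ⊥) i
      bs zero    = combine-dirac zero b
      bs (suc _) = combine-dirac zero b

      r : Dist ℝ 1
      r = mixDist ℝ (complete q) (λ _ → dirac ℝ zero)

    -- For fixed x only the scaling maps t ↦ t · x are known to be continuous.
    -- Writing q ≤ s as q j = s j * (q j / s j) moves the variation of q into
    -- scalars acting on x: Σ q j · x j = Σ s j · ((q j / s j) · x j).
    module _ {n} (s : SubDist ℝ n) (x : Vector Carrier n) where
      fraction : (q : SubDist ℝ n) → (∀ j → weight q j R.≤ weight s j) → Fin n → [0,1] ℝ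
      fraction q q≤s j = ratio-interval (SubDist.nonneg s j) (SubDist.nonneg q j) (q≤s j)

      subcombine-fraction : ∀ q q≤s → subcombine s (λ j → fraction q q≤s j · x j) ≈ subcombine q x
      subcombine-fraction q q≤s = subcombine-· s q (fraction q q≤s) x
        λ j → *-ratio (SubDist.nonneg s j) (SubDist.nonneg q j) (q≤s j)

      -- The fractions are at most `1#` and scaling is monotone in the scalar, so every scaled entry
      -- lies below `one · x j`, which is `x j`.
      subcombine-monoˡ : ∀ q → (∀ j → weight q j R.≤ weight s j) → subcombine q x ≤ subcombine s x
      subcombine-monoˡ q q≤s = trans (reflexive (Eq.sym (subcombine-fraction q q≤s)))
        (IsStrictScottContinuous.monotone (subcombine-continuousʳ s) λ j →
          trans (IsScottContinuous.monotone (·-continuousˡ (x j)) {y = one} (proj₂ (proj₂ (fraction q q≤s j))))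
                (reflexive (1·x≈x (x j))))

      -- The fractions of `d i` by `s` have supremum `one`, so the scaled entries have supremum `x`;
      -- continuity of `subcombine s` in its entries carries this over to the combinations.
      subcombine-lubˡ : ∀ {I : Set ℓ} (d : I → SubDist ℝ n) → IsDirected (subDistPoset ℝ n) d →
                        (∀ j → IsLub R.poset (λ i → weight (d i) j) (weight s j)) →
                        IsLub order (λ i → subcombine (d i) x) (subcombine s x)
      subcombine-lubˡ {I} d dir lubs = lub-resp order (λ i → subcombine-fraction (d i) (d≤s i)) Eq.refl
        (IsStrictScottContinuous.preservesLub (subcombine-continuousʳ s) (λ i j → t j i · x j)
          tx-directed
          (power-lub⁺ order λ j → lub-resp order (λ _ → Eq.refl) (1·x≈x (x j))
            (IsScottContinuous.preservesLub (·-continuousˡ (x j)) (t j) (t-directed j) (t-lub j))))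
        where
        d≤s : ∀ i j → weight (d i) j R.≤ weight s j
        d≤s i j = IsLub.upper (lubs j) i

        t : Fin n → I → [0,1] ℝ
        t j i = fraction (d i) (d≤s i) j

        t-mono : ∀ {i k} → (∀ j → weight (d i) j R.≤ weight (d k) j) →
                 ∀ j → proj₁ (t j i) R.≤ proj₁ (t j k)
        t-mono p j = ratio-mono (SubDist.nonneg s j) (p j)

        t-directed : ∀ j → IsDirected (unitInterval ℝ) (t j)
        t-directed j = record
          { inhabitant = IsDirected.inhabitant dir
          ; bounded = λ i i′ → let (k , p , q) = IsDirected.bounded dir i i′ in
              k , t-mono {i} {k} p j , t-mono {i′} {k} q j
          }

        tx-directed : IsDirected (powerPoset order n) (λ i j → t j i · x j)
        tx-directed = record
          { inhabitant = IsDirected.inhabitant dir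
          ; bounded = λ i i′ → let (k , p , q) = IsDirected.bounded dir i i′ in
              k , (λ j → IsScottContinuous.monotone (·-continuousˡ (x j)) (t-mono {i} {k} p j))
                , (λ j → IsScottContinuous.monotone (·-continuousˡ (x j)) (t-mono {i′} {k} q j))
          }

        t-lub : ∀ j → IsLub (unitInterval ℝ) (t j) one
        t-lub j = record
          { upper = λ i → proj₂ (proj₂ (t j i))
          ; least = λ b → IsLub.least (lub-ratio (SubDist.nonneg s j) (IsDirected.inhabitant dir) (lubs j)) (proj₁ b)
          }

  private
    𝐃 = EnrichedCategory.category (Dcpo⊥! ℓ)
    𝐋 = EnrichedCategory.category (𝕃 ℝ)
    module 𝐃 = Category 𝐃
    module 𝐋 = Category 𝐋
  open StrictMap

  -- From Kegelspitzen to models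

  module Powers (X : Kegelspitze ℝ) where
    open Kegelspitze X
    open Subconvex X

    subcombineMap : ∀ {n m} → Arr ℝ n m → StrictMap (power pointedDcpo n) (power pointedDcpo m)
    subcombineMap f = tupleMap λ k →
      record { apply = subcombine (f k) ; isStrictScottContinuous = subcombine-continuousʳ (f k) }

    powers : Functor 𝐋 𝐃
    powers = record
      { F₀ = power pointedDcpo
      ; F₁ = subcombineMap
      ; F₁-cong = λ {_} {_} {f} {g} f≈g x k →
          subcombine-cong {q = f k} {g k} (f≈g k) (λ _ → Eq.refl)
      ; F₁-id = λ x k → subcombine-dirac k x
      ; F₁-∙ = λ g f x k → Eq.sym (subcombine-assoc (g k) f x)
      }

    block : ∀ {k} (A : Vector ℕ k) i → Arr ℝ (total A) (A i)
    block A i a = subDist ℝ (dirac ℝ (inject A i a))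

    -- Dirac vectors select coordinates, so the maps given by `block` merely regroup the coordinates
    -- of a vector along `inject` and `locate`.
    block-isProduct : ∀ {k} (A : Vector ℕ k) →
      IsProduct 𝐃 (power pointedDcpo ∘ A) (power pointedDcpo (total A)) (subcombineMap ∘ block A)
    block-isProduct A f =
        tupleMap (λ j → let (i , a) = locate A j in lookupMap pointedDcpo a 𝐃.∙ f i)
      , (λ i y a → Eq.trans (subcombine-dirac (inject A i a) _)
          (Eq.reflexive (≡.cong (λ (i , a) → apply (f i) y a) (locate-inject A i a))))
      , (λ v v≈f y j → let (i , a) = locate A j in
          Eq.trans (Eq.reflexive (≡.cong (apply v y) (≡.sym (inject-locate A j))))
            (Eq.trans (Eq.sym (subcombine-dirac (inject A i a) (apply v y))) (v≈f i y a)))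

    abstract
      -- Every product cone of `𝕃` factors through the standard cone `block`, by collecting all rows
      -- of the `π i` into `w`; `preservesProduct` then transfers the product property.
      preserves : PreservesFiniteProducts powers
      preserves A P π = preservesProduct powers w block-w (block-isProduct A)
        where
        w : Arr ℝ P (total A)
        w j = let (i , a) = locate A j in π i a

        block-w : ∀ i → block A i 𝐋.∙ w 𝐋.≈ π i
        block-w i a j = R.trans (sum-δˡ ℝ (inject A i a) (λ l → weight (w l) j))
          (R.reflexive (≡.cong (λ (i , a) → weight (π i a) j) (locate-inject A i a)))

      locallyContinuous : LocallyStrictScottContinuous {C = 𝕃 ℝ} {D = Dcpo⊥! ℓ} powers
      locallyContinuous n m = record
        { isScottContinuous = record
          { monotone = λ {f} {g} f≤g x k → subcombine-monoˡ (g k) x (f k) (f≤g k)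
          ; preservesLub = λ d dir {s} s-lub →
              let lub = λ x k → subcombine-lubˡ (s k) x (λ i → d i k)
                    (directed-map (Arr-poset ℝ n m) (subDistPoset ℝ n) {λ f → f k} (λ p → p k) dir)
                    (𝕃-lub⁻ ℝ {d = d} {s} dir s-lub k)
              in record
                { upper = λ i x k → IsLub.upper (lub x k) i
                ; least = λ b d≤b x k → IsLub.least (lub x k) _ λ i → d≤b i x k
                }
          }
        -- The completion of the zero vector is the Dirac vector at `zero`, which selects the entry
        -- `⊥`.
        ; strict = λ x k → Eq.trans
            (combine-cong {r = complete zeroArrow} {dirac ℝ zero}
              (Dist-≈ (complete zeroArrow) (dirac ℝ zero) λ _ → R.refl) (λ _ → Eq.refl))
            (combine-dirac zero (⊥ ∷ x))
        }
        where
        zeroArrow : SubDist ℝ n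
        zeroArrow = PointedDcpo.⊥ (subDistDcpo ℝ n)

    model : Model ℝ
    model .Model.functor = powers
    model .Model.preservesFiniteProducts = preserves
    model .Model.locallyStrictScottContinuous = locallyContinuous

  open Powers using (powers; model)

  powerMap : ∀ {X Y} → AffineMap ℝ X Y → NaturalTransformation (powers X) (powers Y)
  powerMap {X} {Y} f = record
    { component = λ n → tupleMap λ k → strictMap 𝐃.∙ lookupMap X.pointedDcpo k
    -- Affinity moves `f` inside the completed combination, and strictness handles the added entry
    -- `⊥`.
    ; natural = λ q x k → Y.Eq.trans (affine (complete (q k)) (X.⊥ ∷ x))
        (Y.combine-cong {r = complete (q k)} {complete (q k)} (λ _ → R.refl)
          λ { zero → strict strictMap ; (suc i) → Y.Eq.refl })
    }
    where
    open AffineMap f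
    module X = Kegelspitze X
    module Y = Kegelspitze Y

  toModels : Functor (KS ℝ) (Models ℝ)
  toModels = record
    { F₀ = model
    ; F₁ = powerMap
    ; F₁-cong = λ f≈g n x k → f≈g (x k)
    ; F₁-id = λ {X} n x k → Kegelspitze.Eq.refl X
    ; F₁-∙ = λ {_} {_} {Z} g f n x k → Kegelspitze.Eq.refl Z
    }

  -- From models to Kegelspitzen

  apply-continuous : (X Y : PointedDcpo ℓ ℓ) (x : ∣ X ∣) →
    IsScottContinuous (strictMapPoset X Y) (PointedDcpo.poset Y) (λ f → apply f x)
  apply-continuous X Y x = record
    { monotone = λ f≤g → f≤g x
    ; preservesLub = λ d dir {s} s-lub → strictMap-lub⁻ X Y {d = d} {s} dir s-lub x
    }

  -- An upper bound up to `1#` is itself a point of the interval, being nonnegative thanks to `i₀`;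
  -- a larger one exceeds `s` because `s` is at most `1#`.
  interval-lub : ∀ {I : Set ℓ} {t : I → [0,1] ℝ} {s : [0,1] ℝ} → I →
                 IsLub (unitInterval ℝ) t s → IsLub R.poset (proj₁ ∘ t) (proj₁ s)
  interval-lub {t = t} {s} i₀ s-lub = record { upper = IsLub.upper s-lub ; least = least }
    where
    least : ∀ b → (∀ i → proj₁ (t i) R.≤ b) → proj₁ s R.≤ b
    least b t≤b with R.Order.total b R.1#
    ... | inj₁ b≤1 = IsLub.least s-lub
                       (b , R.Order.trans (proj₁ (proj₂ (t i₀))) (t≤b i₀) , b≤1) t≤b
    ... | inj₂ 1≤b = R.Order.trans (proj₂ (proj₂ s)) 1≤b

  row : ∀ {n} → SubDist ℝ n → Arr ℝ n 1
  row q _ = q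

  scalar : [0,1] ℝ → Arr ℝ 1 1
  scalar t = row (scaledDirac t zero)

  scalar-continuous : IsScottContinuous (unitInterval ℝ) (Arr-poset ℝ 1 1) scalar
  scalar-continuous = record
    { monotone = λ t≤t′ _ j → *-monoˡ-≤ ℝ (δ-nonneg ℝ zero j) t≤t′
    ; preservesLub = λ t dir {s} s-lub → 𝕃-lub⁺ ℝ {d = scalar ∘ t} {scalar s} λ _ j →
        lub-resp R.poset (λ _ → R.*-comm _ _) (R.*-comm _ _)
          (lub-* ℝ (IsDirected.inhabitant dir) (δ-nonneg ℝ zero j)
            (interval-lub (IsDirected.inhabitant dir) s-lub))
    }

  proj : ∀ {n} → Fin n → Arr ℝ n 1
  proj i = row (subDist ℝ (dirac ℝ i))

  -- An arrow into `n` is by definition a family of `n` rows, that is, of arrows into `1`; composing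
  -- with a Dirac row picks one of them out.
  proj-isProduct : ∀ n → IsProduct 𝐋 (λ _ → 1) n proj
  proj-isProduct n f =
      (λ i → f i zero)
    , (λ { i zero j → sum-δˡ ℝ i (λ l → weight (f l zero) j) })
    , (λ v v≈f i j → R.trans (R.sym (sum-δˡ ℝ i (λ l → weight (v l) j))) (v≈f i zero j))

  -- The Kegelspitze structure on the value of a model at 1

  module Algebra (M : Model ℝ) where
    open Model M
    open Functor functor

    private
      module F n = PointedDcpo (F₀ n)
    open PointedDcpo (F₀ 1)

    abstract
      -- Product preservation makes `F₀ n` an `n`-fold power of `F₀ 1`, so the coordinate maps of
      -- the concrete power factor through it. This comparison map turns out to be inverse to
      -- `untuple`.
      tupleMorphism : ∀ n → Σ (StrictMap (power (F₀ 1) n) (F₀ n)) λ u →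
        ∀ i → F₁ (proj i) 𝐃.∙ u 𝐃.≈ lookupMap (F₀ 1) i
      tupleMorphism n =
        let (u , πu≈lookup , _) =
              preservesFiniteProducts (λ _ → 1) n proj (proj-isProduct n) (lookupMap (F₀ 1))
        in u , πu≈lookup

    tuple : ∀ {n} → StrictMap (power (F₀ 1) n) (F₀ n)
    tuple = proj₁ (tupleMorphism _)

    untuple : ∀ {n} → StrictMap (F₀ n) (power (F₀ 1) n)
    untuple = tupleMap (λ i → F₁ (proj i))

    abstract
      untuple-tuple : ∀ {n} (x : Vector Carrier n) i → apply (F₁ (proj i)) (apply tuple x) ≈ x i
      untuple-tuple x i = proj₂ (tupleMorphism _) i x

      proj-monic : ∀ {n Y} (v w : StrictMap Y (F₀ n)) →
                   (∀ i → F₁ (proj i) 𝐃.∙ v 𝐃.≈ F₁ (proj i) 𝐃.∙ w) → v 𝐃.≈ w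
      proj-monic {n} v w p y =
        let (_ , _ , unique) = preservesFiniteProducts (λ _ → 1) n proj (proj-isProduct n)
                                 (λ i → F₁ (proj i) 𝐃.∙ w)
        in F.Eq.trans n (unique v p y) (F.Eq.sym n (unique w (λ _ _ → Eq.refl) y))

      tuple-untuple : ∀ {n} (y : F.Carrier n) → F._≈_ n (apply tuple (apply untuple y)) y
      tuple-untuple = proj-monic (tuple 𝐃.∙ untuple) 𝐃.id
        λ i y → untuple-tuple (apply untuple y) i

      tuple-unique : ∀ {n} {x : Vector Carrier n} {y : F.Carrier n} →
                     (∀ i → apply (F₁ (proj i)) y ≈ x i) → F._≈_ n (apply tuple x) y
      tuple-unique {n} {y = y} p =
        F.Eq.trans n (cong tuple (Eq.sym ∘ p)) (tuple-untuple y)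

      proj-F₁ : ∀ {n m} (f : Arr ℝ n m) k y →
                apply (F₁ (proj k)) (apply (F₁ f) y) ≈ apply (F₁ (row (f k))) y
      proj-F₁ f k y = Eq.trans (Eq.sym (F₁-∙ (proj k) f y))
        (F₁-cong {f = proj k 𝐋.∙ f} {row (f k)} (λ _ j → sum-δˡ ℝ k (λ l → weight (f l) j)) y)

      -- Once a tuple is recognised as a value of `F₁ f`, a further application of `F₁` to it
      -- becomes a composite in `𝕃`, and identities in the model reduce to identities of weights.
      F₁-tuple : ∀ {n m} (f : Arr ℝ n m) {x : Vector Carrier m} y →
                 (∀ k → apply (F₁ (row (f k))) y ≈ x k) → F._≈_ m (apply tuple x) (apply (F₁ f) y)
      F₁-tuple f y p = tuple-unique λ k → Eq.trans (proj-F₁ f k y) (p k)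

      -- Local strictness sends the zero arrow to the least map, which is constantly `⊥`.
      F₁-⊥ : ∀ {n} (y : F.Carrier n) → apply (F₁ (row (PointedDcpo.⊥ (subDistDcpo ℝ n)))) y ≈ ⊥
      F₁-⊥ {n} y = IsStrictScottContinuous.strict (locallyStrictScottContinuous n 1) y

    combine : ∀ {m} → Dist ℝ m → Vector Carrier m → Carrier
    combine r x = apply (F₁ (row (subDist ℝ r))) (apply tuple x)

    convexStructure : ConvexStructure ℝ setoid
    convexStructure = record
      { combine = combine
      ; combine-cong = λ {_} {r} {s} r≈s x≈y → Eq.trans
          (F₁-cong {f = row (subDist ℝ r)} {row (subDist ℝ s)} (λ _ → r≈s) _)
          (cong (F₁ (row (subDist ℝ s))) (cong tuple x≈y))
      ; combine-dirac = λ i x → untuple-tuple x i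
      -- The inner combinations are the components of `F₁` at the arrow with rows `s`; composing it
      -- with the row `r` in `𝕃` yields exactly the weights of `mixDist`.
      ; combine-assoc = λ r s x → Eq.trans
          (cong (F₁ (row (subDist ℝ r))) (F₁-tuple (subDist ℝ ∘ s) (apply tuple x) λ _ → Eq.refl))
          (Eq.trans (Eq.sym (F₁-∙ (row (subDist ℝ r)) (subDist ℝ ∘ s) (apply tuple x)))
            (F₁-cong {f = row (subDist ℝ r) 𝐋.∙ (subDist ℝ ∘ s)} {row (subDist ℝ (mixDist ℝ r s))}
                     (λ _ _ → R.refl) (apply tuple x)))
      }

    open ConvexStructure convexStructure using (_⊕[_]_)

    -- The arrow `ι` turns `x` into the pair of `x` and `⊥`, and mixing its rows gives `scalar t`.
    -- Continuity of scaling in `t` thus follows from local continuity of the model.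
    ⊕⊥≈scalar : ∀ t x → apply (F₁ (scalar t)) x ≈ x ⊕[ t ] ⊥
    ⊕⊥≈scalar t x = Eq.sym (Eq.trans
      (cong (F₁ (row r)) (F₁-tuple ι x components))
      (Eq.trans (Eq.sym (F₁-∙ (row r) ι x))
        (F₁-cong {f = row r 𝐋.∙ ι} {scalar t} weights x)))
      where
      r : SubDist ℝ 2
      r = subDist ℝ (binary ℝ t)

      ι : Arr ℝ 1 2
      ι = subDist ℝ (dirac ℝ zero) ∷ PointedDcpo.⊥ (subDistDcpo ℝ 1) ∷ []

      components : ∀ k → apply (F₁ (row (ι k))) x ≈ (x ∷ ⊥ ∷ []) k
      components zero       = Eq.trans
        (F₁-cong {f = row (ι zero)} {𝐋.id} (λ { zero _ → R.refl }) x) (F₁-id x)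
      components (suc zero) = F₁-⊥ x

      weights : row r 𝐋.∙ ι 𝐋.≈ scalar t
      weights _ _ = R.trans (R.+-congˡ (R.trans (R.+-identityʳ _) (R.zeroʳ _))) (R.+-identityʳ _)

    kegelspitze : Kegelspitze ℝ
    kegelspitze .Kegelspitze.pointedDcpo = F₀ 1
    kegelspitze .Kegelspitze.convexStructure = convexStructure
    kegelspitze .Kegelspitze.combine-continuous r =
      continuous-∘ (isScottContinuous (F₁ (row (subDist ℝ r)))) (isScottContinuous tuple)
    kegelspitze .Kegelspitze.·-continuousˡ x = continuous-resp (λ t → ⊕⊥≈scalar t x)
      (continuous-∘ (apply-continuous (F₀ 1) (F₀ 1) x)
        (continuous-∘ (IsStrictScottContinuous.isScottContinuous (locallyStrictScottContinuous 1 1))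
                      scalar-continuous))
    kegelspitze .Kegelspitze.·-continuousʳ t =
      continuous-resp (⊕⊥≈scalar t) (isScottContinuous (F₁ (scalar t)))

    open Subconvex kegelspitze using (subcombine)

    -- The arrow `pad` adjoins the entry `⊥`, and `row q` factors through it via the completed row.
    -- Hence convex combinations and `⊥` already determine the action of every subprobability
    -- vector.
    F₁-subcombine : ∀ {n} (q : SubDist ℝ n) (x : Vector Carrier n) →
                    apply (F₁ (row q)) (apply tuple x) ≈ subcombine q x
    F₁-subcombine {n} q x = Eq.sym (Eq.trans
      (cong (F₁ (row r)) (F₁-tuple pad (apply tuple x) components))
      (Eq.trans (Eq.sym (F₁-∙ (row r) pad (apply tuple x)))
        (F₁-cong {f = row r 𝐋.∙ pad} {row q} weights (apply tuple x))))
      where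
      r : SubDist ℝ (suc n)
      r = subDist ℝ (complete q)

      pad : Arr ℝ n (suc n)
      pad = PointedDcpo.⊥ (subDistDcpo ℝ n) ∷ (subDist ℝ ∘ dirac ℝ)

      components : ∀ k → apply (F₁ (row (pad k))) (apply tuple x) ≈ (⊥ ∷ x) k
      components zero    = F₁-⊥ (apply tuple x)
      components (suc i) = untuple-tuple x i

      weights : row r 𝐋.∙ pad 𝐋.≈ row q
      weights _ j = R.trans (R.+-cong (R.zeroʳ _) (sum-δʳ ℝ j (weight q))) (R.+-identityˡ _)

    tuple-natural : ∀ {n m} (f : Arr ℝ n m) (x : Vector Carrier n) →
                    F._≈_ m (apply tuple (λ k → subcombine (f k) x)) (apply (F₁ f) (apply tuple x))
    tuple-natural f x = F₁-tuple f (apply tuple x) λ k → F₁-subcombine (f k) x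

  open Algebra using (kegelspitze)

  -- Natural transformations as affine maps

  module _ {M N : Model ℝ}
           (α : NaturalTransformation (Model.functor M) (Model.functor N)) where
    private
      module M = Algebra M
      module N = Algebra N
      open Functor (Model.functor M) using () renaming (F₁ to M₁)
      open Functor (Model.functor N) using () renaming (F₀ to N₀; F₁ to N₁)
    open NaturalTransformation α

    -- Naturality at the projections determines every component from the one at 1. This yields
    -- affinity of that component and naturality of the counit.
    tuple-component : ∀ {n} (x : Vector (Kegelspitze.Carrier (kegelspitze M)) n) →
      PointedDcpo._≈_ (N₀ n) (apply N.tuple (apply (component 1) ∘ x))
                             (apply (component n) (apply M.tuple x))
    tuple-component {n} x = N.tuple-unique λ i → Kegelspitze.Eq.trans (kegelspitze N)
      (Kegelspitze.Eq.sym (kegelspitze N) (natural (proj i) (apply M.tuple x)))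
      (cong (component 1) (M.untuple-tuple x i))

    affineMap : AffineMap ℝ (kegelspitze M) (kegelspitze N)
    affineMap = record
      { strictMap = component 1
      ; affine = λ {m} r x → Kegelspitze.Eq.trans (kegelspitze N)
          (natural (row (subDist ℝ r)) (apply M.tuple x))
          (cong (N₁ (row (subDist ℝ r))) (PointedDcpo.Eq.sym (N₀ m) (tuple-component x)))
      }

  toKS : Functor (Models ℝ) (KS ℝ)
  toKS = record
    { F₀ = kegelspitze
    ; F₁ = λ {M} {N} → affineMap {M} {N}
    ; F₁-cong = λ {M} {N} {α} {β} α≈β → α≈β 1
    ; F₁-id = λ {M} x → PointedDcpo.Eq.refl (Functor.F₀ (Model.functor M) 1)
    ; F₁-∙ = λ {_} {_} {N} β α x → PointedDcpo.Eq.refl (Functor.F₀ (Model.functor N) 1)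
    }

  -- The equivalence

  module _ (X : Kegelspitze ℝ) where
    private
      X¹ = kegelspitze (model X)
      module X¹ = Kegelspitze X¹
    open Kegelspitze X
    open Subconvex X

    -- The tuple `t` is known only through its projections; as Dirac vectors act by selecting
    -- coordinates, its coordinate `j` must be `y j zero`.
    combine-power₁ : ∀ {m} (r : Dist ℝ m) (y : Vector X¹.Carrier m) →
                     ∀ k → X¹.combine r y k ≈ combine r (λ j → y j zero)
    combine-power₁ {m} r y k = Eq.trans (subcombine-dist r t)
      (combine-cong {r = r} {r} (λ _ → R.refl) λ j →
        Eq.trans (Eq.sym (subcombine-dirac j t)) (Algebra.untuple-tuple (model X) y j zero))
      where
      t : Vector Carrier m
      t = apply (Algebra.tuple (model X)) y

    toPower₁ : AffineMap ℝ X X¹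
    toPower₁ = record
      { strictMap = tupleMap (λ _ → 𝐃.id)
      ; affine = λ r x k → Eq.sym (combine-power₁ r (λ j _ → x j) k)
      }

    fromPower₁ : AffineMap ℝ X¹ X
    fromPower₁ = record
      { strictMap = lookupMap pointedDcpo zero
      ; affine = λ r y → combine-power₁ r y zero
      }

  toPower₁-natural : NaturalTransformation (idFunctor (KS ℝ)) (toKS ∘F toModels)
  toPower₁-natural = record
    { component = toPower₁
    ; natural = λ {_} {Y} f x k → Kegelspitze.Eq.refl Y
    }

  unit : Iso (functorCategory (KS ℝ) (KS ℝ)) (idFunctor (KS ℝ)) (toKS ∘F toModels)
  unit = pointwiseIso {C = KS ℝ} {D = KS ℝ} {F = idFunctor (KS ℝ)} {G = toKS ∘F toModels}
    toPower₁-natural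
    (λ X → fromPower₁ X
         , (λ x → Kegelspitze.Eq.refl X)
         , (λ { y zero → Kegelspitze.Eq.refl X }))

  tuples : ∀ M → NaturalTransformation (powers (kegelspitze M)) (Model.functor M)
  tuples M = record
    { component = λ n → Algebra.tuple M
    ; natural = Algebra.tuple-natural M
    }

  tuplesIso : ∀ M → Iso (functorCategory 𝐋 𝐃) (powers (kegelspitze M)) (Model.functor M)
  tuplesIso M = pointwiseIso (tuples M) λ n →
    Algebra.untuple M , Algebra.untuple-tuple M , Algebra.tuple-untuple M

  tuples-natural : NaturalTransformation (toModels ∘F toKS) (idFunctor (Models ℝ))
  tuples-natural = record
    { component = tuples
    ; natural = λ {M} {N} α n x → tuple-component {M} {N} α x
    }

  counit : Iso (functorCategory (Models ℝ) (Models ℝ)) (toModels ∘F toKS) (idFunctor (Models ℝ))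
  counit = pointwiseIso {C = Models ℝ} {D = Models ℝ} {F = toModels ∘F toKS} {G = idFunctor (Models ℝ)}
    tuples-natural
    -- `Models` is a full subcategory, so an isomorphism of the underlying functors is one of
    -- models.
    λ M → Iso.from (tuplesIso M) , Iso.from∙to (tuplesIso M) , Iso.to∙from (tuplesIso M)

theorem2p4 : ∀ {ℓ} (ℝ : CompleteOrderedField ℓ) → Equivalence (KS ℝ) (Models ℝ)
theorem2p4 ℝ = record { F = toModels ℝ ; G = toKS ℝ ; unit = unit ℝ ; counit = counit ℝ }
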